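{- Let $k\ge 3$ be an integer (the parameter). Every $\mathrm{p\text{ - }Res}(1)$ refutation of $(\mathrm{RLNP}_n,k)$ is of size $\ge n^{\sqrt{(k-3)/16}}$.
   Context: Notation: $[n]=\{1,\dots,n\}$. A clause is a disjunction of literals (propositional variables or their negations). Resolution (also denoted $\mathrm{Res}(1)$): from clauses $\mathcal P\vee x$ and $\mathcal Q\vee\neg x$ derive $\mathcal P\vee\mathcal Q$ (resolution rule); from $\mathcal P$ derive $\mathcal P\vee\ell$ for any literal $\ell$ (weakening). A Resolution refutation of a set of clauses is a derivation of the empty clause from these clauses (axioms), viewed as a directed acyclic graph whose sources are axioms and whose only sink is the empty clause. Its size is the number of internal nodes, i.e. the number of rule applications. Parameterized Resolution $\mathrm{p\text{ - }Res}(1)$: for a CNF (set of clauses) $\mathcal F$ in variables $x_1,\dots,x_N$ and a parameter $k$, a $\mathrm{p\text{ - }Res}(1)$ refutation of $(\mathcal F,k)$ is a Resolution refutation of $$\mathcal F\cup\{\neg x_{i_1}\vee\dots\vee\neg x_{i_{k+1}} : 1\le i_1<\dots<i_{k+1}\le N\}.$$ (The additional clauses are available as axioms; only those that actually appear in the refutation are counted.) The contradiction $\mathrm{RLNP}_n$ (relativized Least number principle). Variables: $R_i$ for $i\in[n]$, and $L_{i,j}$, $S_{i,j}$ for $i,j\in[n]$. The clauses are: $\neg R_i\vee\neg L_{i,i}$ for $i\in[n]$; $\neg R_i\vee\neg R_j\vee\neg R_\ell\vee\neg L_{i,j}\vee\neg L_{j,\ell}\vee L_{i,\ell}$ for $i,j,\ell\in[n]$;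 $\bigvee_{i\in[n]}S_{i,j}$ for $j\in[n]$; $\neg S_{i,j}\vee\neg R_j\vee R_i$ for $i,j\in[n]$; $\neg S_{i,j}\vee\neg R_j\vee L_{i,j}$ for $i,j\in[n]$; $R_n$.
   Formalization: The bound is proved for each fixed k and all n ≥ n₀(k); for all n it fails: RLNP_2 has 10 variables, hence a refutation of size below 2^10 for every k, while 2^√((k-3)/16) ≥ 2^10 once k ≥ 1603. -}

module Defs where

open import Data.Fin.Base using (Fin; toℕ) renaming (_<_ to _<ᶠ_)
open import Data.List.Base using (List; []; _∷_; _++_; map; length; allFin)
open import Data.List.Membership.Propositional using (_∈_)
open import Data.List.Relation.Binary.BagAndSetEquality using (_∼[_]_; set)
open import Data.List.Relation.Unary.Unique.Propositional using (Unique)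
open import Data.Nat.Base using (ℕ; suc; _*_; _^_; _≤_; NonZero)
open import Data.Product.Base using (∃; ∃-syntax; _×_; proj₁)
open import Data.Sum.Base using (_⊎_; inj₁; inj₂; [_,_]′)
open import Relation.Binary.PropositionalEquality using (_≡_)
open import Relation.Nullary using (¬_)
open import Relation.Unary using (Pred; _∪_)
open import Level using (0ℓ)

data Literal (V : Set) : Set where
  pos neg : V → Literal V

-- Clauses are finite sets of literals: lists, compared only up to `_≋_`.
Clause : Set → Set
Clause V = List (Literal V)

infix 4 _≋_
_≋_ : ∀ {V} → Clause V → Clause V → Set
C ≋ D = C ∼[ set ] D

ClauseSet : Set → Set₁
ClauseSet V = Pred (Clause V) 0ℓ

data Inference {V N : Set} (label : N → Clause V) (C : Clause V) : Set where
  resolution : ∀ {P Q} (x : V) (a b : N) →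
               label a ≋ pos x ∷ P → label b ≋ neg x ∷ Q →
               C ≋ P ++ Q → Inference label C
  weakening  : (ℓ : Literal V) (a : N) → C ≋ ℓ ∷ label a → Inference label C

premises : ∀ {V N} {label : N → Clause V} {C} → Inference label C → List N
premises (resolution _ a b _ _ _) = a ∷ b ∷ []
premises (weakening _ a _)        = a ∷ []

-- The internal nodes are numbered in a topological order.  By `acyclic`, the
-- last internal node (if there is one) is a sink, so `only-sink` forces it to
-- be the root; the root is an axiom only if there are no internal nodes.
record Refutation {V : Set} (Axiom : ClauseSet V) : Set where
  field
    size : ℕ
    line : Fin size → Clause V

  Node : Set
  Node = ∃ Axiom ⊎ Fin size

  label : Node → Clause V
  label = [ proj₁ , line ]′

  field
    step       : ∀ i → Inference label (line i)
    acyclic    : ∀ i j → inj₂ j ∈ premises (step i) → j <ᶠ i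
    root       : Node
    root-empty : label root ≋ []
    only-sink  : ∀ j → (∀ i → ¬ (inj₂ j ∈ premises (step i))) → root ≡ inj₂ j

open Refutation public using (size)

WeightAxiom : ∀ {V} → ℕ → ClauseSet V
WeightAxiom {V} k C =
  ∃[ xs ] Unique {A = V} xs × length xs ≡ suc k × C ≡ map neg xs

p-Res₁-Refutation : ∀ {V} → ClauseSet V → ℕ → Set
p-Res₁-Refutation F k = Refutation (F ∪ WeightAxiom k)

data Var (n : ℕ) : Set where
  R   : Fin n → Var n
  L S : Fin n → Fin n → Var n

-- `i : Fin n` stands for the element toℕ i + 1 of [n].
data RLNP (n : ℕ) : ClauseSet (Var n) where
  irreflexive : ∀ i → RLNP n (neg (R i) ∷ neg (L i i) ∷ [])
  transitive  : ∀ i j l → RLNP n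
    (neg (R i) ∷ neg (R j) ∷ neg (R l) ∷ neg (L i j) ∷ neg (L j l) ∷ pos (L i l) ∷ [])
  witness     : ∀ j → RLNP n (map (λ i → pos (S i j)) (allFin n))
  witness-R   : ∀ i j → RLNP n (neg (S i j) ∷ neg (R j) ∷ pos (R i) ∷ [])
  witness-L   : ∀ i j → RLNP n (neg (S i j) ∷ neg (R j) ∷ pos (L i j) ∷ [])
  last-R      : ∀ i → suc (toℕ i) ≡ n → RLNP n (pos (R i) ∷ [])

-- s ≥ n^√(a/b) over the reals, for n ≥ 1: the real power n^α with α ≥ 0 is the
-- supremum of n^(p/q) over the rationals 0 ≤ p/q ≤ α, so the inequality says
-- n^(p/q) ≤ s whenever (p/q)² ≤ a/b.
infix 4 _≥_^√[_/_]
_≥_^√[_/_] : (s n a b : ℕ) .{{_ : NonZero b}} → Set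
s ≥ n ^√[ a / b ] =
  ∀ p q .{{_ : NonZero q}} → b * p ^ 2 ≤ a * q ^ 2 → n ^ p ≤ s ^ q

{-# OPTIONS --safe #-}
module Submission where

-- Write a for the least integer with 16a² > k - 3; it suffices to show that
-- n^a = O(size), as the gap between a and √((k-3)/16) absorbs the constant.
-- An adversary draws a constant number of "alive" elements, among them n; R holds
-- for these only. Variables L i j with i or j dead and S i j with j dead get random
-- values, true with probability about n^(-1/2), and S i j is false for i dead and
-- j alive. If the refutation is small then, by the union bound, some choice makes
-- every line either satisfied by the random values or mention few alive elements
-- and have fewer than 2a random negated variables. Descend from the root along
-- falsified lines, keeping on the alive elements an order whose least element z is
-- not mentioned by the line: before each resolution step a fresh element is put
-- below all others and becomes the witness of the old z. The only axiom of RLNP on the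
-- alive elements that such an order falsifies, ⋁ᵢ S i z, mentions z. At a weight axiom
-- at least k negated variables of the line would be true; but at most 2a - 1 of them
-- are random, and the others lie on at most a alive elements, which leaves room for
-- only a(2a - 1), and 16(a - 1)² + 3 ≤ k makes these too few.

open import Data.Bool.Base using (Bool; true; false; not; if_then_else_)
import Data.Bool.Properties as Bool
open import Data.Empty using (⊥)
open import Data.Fin.Base using (Fin; toℕ; fromℕ) renaming (_<_ to _<ᶠ_)
import Data.Fin.Induction as Fin
import Data.Fin.Properties as Fin
open import Data.Fin.Properties using () renaming (_≟_ to _≟ᶠ_)
open import Data.List.Base using (List; []; _∷_; _++_; map; length; allFin; filter; concatMap; take; cartesianProductWith)
open import Data.List.Properties using (length-++; length-tabulate; length-map; length-take; length-filter; take-all; take++drop≡id; filter-notAll)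
import Data.List.Membership.DecPropositional as DecMembership
open import Data.List.Membership.Propositional using (_∈_; _∉_; find; lose)
open import Data.List.Membership.Propositional.Properties
open import Data.List.Relation.Binary.Subset.Propositional using (_⊆_)
open import Data.List.Relation.Binary.Subset.Propositional.Properties using (Any-resp-⊆)
open import Data.List.Relation.Unary.All as All using ([]; _∷_)
open import Data.List.Relation.Unary.AllPairs using ([]; _∷_)
open import Data.List.Relation.Unary.Any as Any using (Any; here; there; any?)
open import Data.List.Relation.Unary.Unique.Propositional using (Unique)
import Data.List.Relation.Unary.Unique.Propositional.Properties as Unique
open import Data.Maybe.Base using (Maybe; just; nothing)
import Data.Maybe.Properties as Maybe
open import Data.Nat
open import Data.Nat.ListAction using (sum; product)
open import Data.Nat.Properties
open import Data.Nat.Tactic.RingSolver using (solve-∀)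
open import Data.Product using (∃; ∃-syntax; _×_; _,_; proj₁; proj₂)
open import Data.Sum using (_⊎_; inj₁; inj₂)
open import Function using (_∘_; id)
open import Function.Bundles using (Equivalence)
open import Induction.WellFounded using (Acc; acc)
open import Level using (0ℓ)
open import Relation.Binary.Definitions using (DecidableEquality)
open import Relation.Binary.PropositionalEquality hiding (J)
open import Relation.Nullary using (¬_; Dec; yes; no; contradiction; ¬?; does)
open import Relation.Nullary.Decidable using (_×-dec_; _⊎-dec_; dec-true; dec-false; map′)
open import Relation.Unary using (Decidable; Pred)
open import Defs

private variable
  A V : Set
  n : ℕ

-- Counting and averaging over finite lists.

remove-⊆ : ∀ {x : A} {xs} ys {zs} → x ∉ xs → xs ⊆ ys ++ x ∷ zs → xs ⊆ ys ++ zs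
remove-⊆ ys x∉xs xs⊆ {y} y∈xs with ∈-++⁻ ys (xs⊆ y∈xs)
... | inj₁ y∈ys           = ∈-++⁺ˡ y∈ys
... | inj₂ (here refl)    = contradiction y∈xs x∉xs
... | inj₂ (there y∈zs)   = ∈-++⁺ʳ ys y∈zs

Unique-⊆⇒length≤ : ∀ {xs ys : List A} → Unique xs → xs ⊆ ys → length xs ≤ length ys
Unique-⊆⇒length≤ {xs = []} _ _ = z≤n
Unique-⊆⇒length≤ {xs = x ∷ xs} uxs@(_ ∷ u) xs⊆ with ∈-∃++ (xs⊆ (here refl))
... | as , bs , refl = begin
  suc (length xs)             ≤⟨ s≤s (Unique-⊆⇒length≤ u (remove-⊆ as (Unique.Unique[x∷xs]⇒x∉xs uxs) (xs⊆ ∘ there))) ⟩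
  suc (length (as ++ bs))     ≡⟨ cong suc (length-++ as) ⟩
  suc (length as + length bs) ≡⟨ +-suc (length as) (length bs) ⟨
  length as + suc (length bs) ≡⟨ length-++ as ⟨
  length (as ++ x ∷ bs)       ∎
  where open ≤-Reasoning

take-⊆ : ∀ n (xs : List A) → take n xs ⊆ xs
take-⊆ n xs {x} x∈ = subst (x ∈_) (take++drop≡id n xs) (∈-++⁺ˡ x∈)

length-concatMap-≤ : ∀ {B : Set} (f : A → List B) c xs → (∀ {x} → x ∈ xs → length (f x) ≤ c) →
                     length (concatMap f xs) ≤ length xs * c
length-concatMap-≤ f c []       _ = z≤n
length-concatMap-≤ f c (x ∷ xs) h = begin
  length (f x ++ concatMap f xs)         ≡⟨ length-++ (f x) ⟩
  length (f x) + length (concatMap f xs) ≤⟨ +-mono-≤ (h (here refl)) (length-concatMap-≤ f c xs (h ∘ there)) ⟩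
  c + length xs * c                      ∎
  where open ≤-Reasoning

∈-concatMap : ∀ {B : Set} (f : A → List B) {xs x y} → x ∈ xs → y ∈ f x → y ∈ concatMap f xs
∈-concatMap f x∈ y∈ = ∈-concatMap⁺ f (lose x∈ y∈)

sum-map-+ : ∀ (f g : A → ℕ) xs → sum (map (λ x → f x + g x) xs) ≡ sum (map f xs) + sum (map g xs)
sum-map-+ f g []       = refl
sum-map-+ f g (x ∷ xs) rewrite sum-map-+ f g xs = lemma (f x) (g x) (sum (map f xs)) (sum (map g xs))
  where
  lemma : ∀ a b c d → a + b + (c + d) ≡ a + c + (b + d)
  lemma = solve-∀

sum-map-* : ∀ c (f : A → ℕ) xs → sum (map (λ x → c * f x) xs) ≡ c * sum (map f xs)
sum-map-* c f []       = sym (*-zeroʳ c)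
sum-map-* c f (x ∷ xs) rewrite sum-map-* c f xs = sym (*-distribˡ-+ c (f x) _)

sum-map-filter-≤ : ∀ {P : Pred A 0ℓ} (P? : Decidable P) (f : A → ℕ) xs →
                   sum (map f (filter P? xs)) ≤ sum (map f xs)
sum-map-filter-≤ P? f [] = z≤n
sum-map-filter-≤ P? f (x ∷ xs) with does (P? x)
... | true  = +-monoʳ-≤ (f x) (sum-map-filter-≤ P? f xs)
... | false = m≤n⇒m≤o+n (f x) (sum-map-filter-≤ P? f xs)

∈⇒≤sum : ∀ (f : A → ℕ) {x xs} → x ∈ xs → f x ≤ sum (map f xs)
∈⇒≤sum f (here refl) = m≤m+n _ _
∈⇒≤sum f {x} {y ∷ xs} (there p) = m≤n⇒m≤o+n (f y) (∈⇒≤sum f p)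

∃-below-average : ∀ (f : A → ℕ) c x xs → sum (map f (x ∷ xs)) ≤ length (x ∷ xs) * c →
                  ∃ λ y → y ∈ x ∷ xs × f y ≤ c
∃-below-average f c x xs h with f x ≤? c
... | yes fx≤c = x , here refl , fx≤c
∃-below-average f c x [] h | no fx≰c =
  contradiction (subst₂ _≤_ (+-identityʳ (f x)) (+-identityʳ c) h) fx≰c
∃-below-average f c x (y ∷ xs) h | no fx≰c =
  let (z , z∈ , fz≤c) = ∃-below-average f c y xs
        (+-cancelˡ-≤ c _ _ (≤-trans (+-monoˡ-≤ _ (<⇒≤ (≰⇒> fx≰c))) h))
  in z , there z∈ , fz≤c

module _ {F : ℕ → ℕ} where
  -- The search runs down from `b` and stops at the first x with F x ≤ N. It provides the integer
  -- roots that fix a and r below.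
  bracket : ∀ {N} b → F 0 ≤ N → N < F b → ∃[ x ] F x ≤ N × N < F (suc x)
  bracket zero    F0≤N N<F0 = contradiction N<F0 (≤⇒≯ F0≤N)
  bracket {N} (suc b) F0≤N N<Fb with N <? F b
  ... | yes N<F = bracket b F0≤N N<F
  ... | no  N≮F = b , ≮⇒≥ N≮F , N<Fb

-- Choosing the random values by conditional expectations.

module Conditioning (_≟_ : DecidableEquality V) where

  -- A target encodes a disjunction of literals: `just b` at x stands for the literal that x = b
  -- satisfies. Meeting the target means satisfying the disjunction.
  Target : Set
  Target = V → Maybe Bool

  _≟ᴹ_ : DecidableEquality (Maybe Bool)
  _≟ᴹ_ = Maybe.≡-dec Bool._≟_

  missed : V → Bool → List Target → List Target
  missed x b = filter (λ g → ¬? (g x ≟ᴹ just b))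

  infixl 6 _[_≔_]
  _[_≔_] : (V → Bool) → V → Bool → V → Bool
  (α [ x ≔ b ]) y with x ≟ y
  ... | yes _ = b
  ... | no  _ = α y

  ≔-same : ∀ α x b → (α [ x ≔ b ]) x ≡ b
  ≔-same α x b with x ≟ x
  ... | yes _  = refl
  ... | no x≢x = contradiction refl x≢x

  ≔-other : ∀ α {x y} b → x ≢ y → (α [ x ≔ b ]) y ≡ α y
  ≔-other α {x} {y} b x≢y with x ≟ y
  ... | yes x≡y = contradiction x≡y x≢y
  ... | no _    = refl

  Meets : List V → (V → Bool) → Target → Set
  Meets vs α g = ∃ λ x → x ∈ vs × g x ≡ just (α x)

  targeted falseTargeted : List V → Target → List V
  targeted      vs g = filter (λ x → ¬? (g x ≟ᴹ nothing)) vs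
  falseTargeted vs g = filter (λ x → g x ≟ᴹ just false) vs

  module _ (c : ℕ) where

    -- (c+1) times the probability of missing a target at one variable.
    weight : Maybe Bool → ℕ
    weight nothing      = suc c
    weight (just true)  = c
    weight (just false) = 1

    missWeight : List V → Target → ℕ
    missWeight vs g = product (map (weight ∘ g) vs)

    -- Condition on x, which is false with probability c/(c+1) and true with probability 1/(c+1); in
    -- either case only the targets missed at x still count.
    missWeight-split : ∀ x vs gs → sum (map (missWeight (x ∷ vs)) gs) ≡
      c * sum (map (missWeight vs) (missed x false gs)) + sum (map (missWeight vs) (missed x true gs))
    missWeight-split x vs [] = sym (trans (+-identityʳ _) (*-zeroʳ c))
    missWeight-split x vs (g ∷ gs) with g x | missWeight-split x vs gs
    ... | nothing    | ih rewrite ih = lemma c (missWeight vs g) _ _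
      where
      lemma : ∀ c w s t → suc c * w + (c * s + t) ≡ c * (w + s) + (w + t)
      lemma = solve-∀
    ... | just true  | ih rewrite ih = lemma c (missWeight vs g) _ _
      where
      lemma : ∀ c w s t → c * w + (c * s + t) ≡ c * (w + s) + t
      lemma = solve-∀
    ... | just false | ih rewrite ih = lemma c (missWeight vs g) _ _
      where
      lemma : ∀ c w s t → 1 * w + (c * s + t) ≡ c * s + (w + t)
      lemma = solve-∀

    -- The method of conditional expectations, `true` having probability 1/(c+1):
    -- some value of x does not increase the expected number of missed targets.
    meet-all : ∀ {vs} → Unique vs → ∀ gs → sum (map (missWeight vs) gs) < suc c ^ length vs →
               ∃ λ α → ∀ {g} → g ∈ gs → Meets vs α g
    meet-all {[]} _ []       _ = (λ _ → false) , λ ()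
    -- With no variable left each target weighs 1, while the total is below 1.
    meet-all {[]} _ (g ∷ gs) h = contradiction h (≤⇒≯ (s≤s z≤n))
    meet-all {x ∷ vs} uxvs@(_ ∷ uvs) gs h = result
      where
      N = suc c ^ length vs
      extend : ∀ b → sum (map (missWeight vs) (missed x b gs)) < N →
               ∃ λ α → ∀ {g} → g ∈ gs → Meets (x ∷ vs) α g
      extend b <N with meet-all uvs (missed x b gs) <N
      ... | α , meets = α [ x ≔ b ] , meets′
        where
        meets′ : ∀ {g} → g ∈ gs → Meets (x ∷ vs) (α [ x ≔ b ]) g
        meets′ {g} g∈ with g x ≟ᴹ just b
        ... | yes gx≡b = x , here refl , trans gx≡b (cong just (sym (≔-same α x b)))
        ... | no  gx≢b with meets (∈-filter⁺ (λ g → ¬? (g x ≟ᴹ just b)) g∈ gx≢b)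
        ... | y , y∈ , gy = y , there y∈ , trans gy (cong just (sym (≔-other α b
                λ x≡y → Unique.Unique[x∷xs]⇒x∉xs uxvs (subst (_∈ vs) (sym x≡y) y∈))))
      result : ∃ λ α → ∀ {g} → g ∈ gs → Meets (x ∷ vs) α g
      result with sum (map (missWeight vs) (missed x false gs)) <? N | sum (map (missWeight vs) (missed x true gs)) <? N
      ... | yes lt | _      = extend false lt
      ... | no _   | yes lt = extend true lt
      ... | no ge₀ | no ge₁ = contradiction h (≤⇒≯ (begin
        N + c * N  ≡⟨ +-comm N (c * N) ⟩
        c * N + N  ≤⟨ +-mono-≤ (*-monoʳ-≤ c (≮⇒≥ ge₀)) (≮⇒≥ ge₁) ⟩
        _          ≡⟨ missWeight-split x vs gs ⟨
        sum (map (missWeight (x ∷ vs)) gs) ∎))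
        where open ≤-Reasoning

    -- Each targeted variable is missed with probability at most c/(c+1); for the target false,
    -- missed with probability 1/(c+1), this is where 1 ≤ c enters.
    missWeight-targeted : ∀ vs g → 1 ≤ c →
      missWeight vs g * suc c ^ length (targeted vs g) ≤ c ^ length (targeted vs g) * suc c ^ length vs
    missWeight-targeted []       g 1≤c = ≤-refl
    missWeight-targeted (x ∷ vs) g 1≤c with g x | missWeight-targeted vs g 1≤c
    ... | nothing    | ih = begin
      suc c * w * e     ≡⟨ *-assoc (suc c) w e ⟩
      suc c * (w * e)   ≤⟨ *-monoʳ-≤ (suc c) ih ⟩
      suc c * (f * N)   ≡⟨ lemma (suc c) f N ⟩
      f * (suc c * N)   ∎
      where
      open ≤-Reasoning
      w = missWeight vs g
      e = suc c ^ length (targeted vs g)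
      f = c ^ length (targeted vs g)
      N = suc c ^ length vs
      lemma : ∀ a b c → a * (b * c) ≡ b * (a * c)
      lemma = solve-∀
    ... | just b | ih = begin
      weight (just b) * w * (suc c * e) ≤⟨ *-monoˡ-≤ (suc c * e) (*-monoˡ-≤ w (weight≤c b)) ⟩
      c * w * (suc c * e)               ≡⟨ lemma₁ c w e ⟩
      c * (suc c * (w * e))             ≤⟨ *-monoʳ-≤ c (*-monoʳ-≤ (suc c) ih) ⟩
      c * (suc c * (f * N))             ≡⟨ lemma₂ c f N ⟩
      c * f * (suc c * N)               ∎
      where
      open ≤-Reasoning
      w = missWeight vs g
      e = suc c ^ length (targeted vs g)
      f = c ^ length (targeted vs g)
      N = suc c ^ length vs
      weight≤c : ∀ b → weight (just b) ≤ c
      weight≤c true  = ≤-refl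
      weight≤c false = 1≤c
      lemma₁ : ∀ c w e → c * w * (suc c * e) ≡ c * (suc c * (w * e))
      lemma₁ = solve-∀
      lemma₂ : ∀ c f N → c * (suc c * (f * N)) ≡ c * f * (suc c * N)
      lemma₂ = solve-∀

    -- The target false is missed only by the value true, of probability 1/(c+1); all other factors
    -- are at most 1.
    missWeight-falseTargeted : ∀ vs g →
      missWeight vs g * suc c ^ length (falseTargeted vs g) ≤ suc c ^ length vs
    missWeight-falseTargeted []       g = ≤-refl
    missWeight-falseTargeted (x ∷ vs) g with g x | missWeight-falseTargeted vs g
    ... | nothing    | ih = begin
      suc c * w * e   ≡⟨ *-assoc (suc c) w e ⟩
      suc c * (w * e) ≤⟨ *-monoʳ-≤ (suc c) ih ⟩
      _               ∎
      where
      open ≤-Reasoning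
      w = missWeight vs g
      e = suc c ^ length (falseTargeted vs g)
    ... | just true  | ih = begin
      c * w * e       ≡⟨ *-assoc c w e ⟩
      c * (w * e)     ≤⟨ *-mono-≤ (n≤1+n c) ih ⟩
      _               ∎
      where
      open ≤-Reasoning
      w = missWeight vs g
      e = suc c ^ length (falseTargeted vs g)
    ... | just false | ih = begin
      1 * w * (suc c * e) ≡⟨ lemma w (suc c) e ⟩
      suc c * (w * e)     ≤⟨ *-monoʳ-≤ (suc c) ih ⟩
      _                   ∎
      where
      open ≤-Reasoning
      w = missWeight vs g
      e = suc c ^ length (falseTargeted vs g)
      lemma : ∀ w d e → 1 * w * (d * e) ≡ d * (w * e)
      lemma = solve-∀

    -- Union bound: under either alternative a target is missed with probability at most 1/Q, and
    -- there are fewer than Q targets.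
    meet-heavy : ∀ {vs} → Unique vs → 1 ≤ c → ∀ t e Q gs →
      c ^ t * Q ≤ suc c ^ t → Q ≤ suc c ^ e →
      (∀ {g} → g ∈ gs → t ≤ length (targeted vs g) ⊎ e ≤ length (falseTargeted vs g)) →
      length gs < Q → ∃ λ α → ∀ {g} → g ∈ gs → Meets vs α g
    meet-heavy {vs} uvs 1≤c t e Q gs hₜ hₑ heavy gs<Q = meet-all uvs gs
      (*-cancelʳ-< Q _ _ (begin-strict
        sum (map (missWeight vs) gs) * Q ≤⟨ sum-bound gs heavy ⟩
        length gs * N                    <⟨ *-monoˡ-< N {{m^n≢0 (suc c) (length vs)}} gs<Q ⟩
        Q * N                            ≡⟨ *-comm Q N ⟩
        N * Q                            ∎))
      where
      open ≤-Reasoning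
      N = suc c ^ length vs
      swap₂₃ : ∀ x y z → x * y * z ≡ x * z * y
      swap₂₃ = solve-∀
      bound : ∀ g → t ≤ length (targeted vs g) ⊎ e ≤ length (falseTargeted vs g) →
              missWeight vs g * Q ≤ N
      bound g (inj₁ t≤) = *-cancelʳ-≤ _ _ (suc c ^ length (targeted vs g)) {{m^n≢0 (suc c) (length (targeted vs g))}} (begin
        w * Q * suc c ^ l          ≡⟨ swap₂₃ w Q (suc c ^ l) ⟩
        w * suc c ^ l * Q          ≤⟨ *-monoˡ-≤ Q (missWeight-targeted vs g 1≤c) ⟩
        c ^ l * N * Q              ≡⟨ swap₂₃ (c ^ l) N Q ⟩
        c ^ l * Q * N              ≤⟨ *-monoˡ-≤ N decay ⟩
        suc c ^ l * N              ≡⟨ *-comm (suc c ^ l) N ⟩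
        N * suc c ^ l              ∎)
        where
        w = missWeight vs g
        l = length (targeted vs g)
        -- The inequality for t passes to every l ≥ t, as each further factor c is below c + 1.
        decay : c ^ l * Q ≤ suc c ^ l
        decay = begin
          c ^ l * Q                       ≡⟨ cong (λ l → c ^ l * Q) (m+[n∸m]≡n t≤) ⟨
          c ^ (t + (l ∸ t)) * Q           ≡⟨ cong (_* Q) (^-distribˡ-+-* c t (l ∸ t)) ⟩
          c ^ t * c ^ (l ∸ t) * Q         ≡⟨ swap₂₃ (c ^ t) _ Q ⟩
          c ^ t * Q * c ^ (l ∸ t)         ≤⟨ *-mono-≤ hₜ (^-monoˡ-≤ (l ∸ t) (n≤1+n c)) ⟩
          suc c ^ t * suc c ^ (l ∸ t)     ≡⟨ ^-distribˡ-+-* (suc c) t (l ∸ t) ⟨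
          suc c ^ (t + (l ∸ t))           ≡⟨ cong (suc c ^_) (m+[n∸m]≡n t≤) ⟩
          suc c ^ l                       ∎
      bound g (inj₂ e≤) = begin
        missWeight vs g * Q                                     ≤⟨ *-monoʳ-≤ (missWeight vs g) (≤-trans hₑ (^-monoʳ-≤ (suc c) e≤)) ⟩
        missWeight vs g * suc c ^ length (falseTargeted vs g)   ≤⟨ missWeight-falseTargeted vs g ⟩
        N                                                       ∎
      sum-bound : ∀ gs → (∀ {g} → g ∈ gs → t ≤ length (targeted vs g) ⊎ e ≤ length (falseTargeted vs g)) →
                  sum (map (missWeight vs) gs) * Q ≤ length gs * N
      sum-bound []       _ = z≤n
      sum-bound (g ∷ gs) h = begin
        (missWeight vs g + sum (map (missWeight vs) gs)) * Q   ≡⟨ *-distribʳ-+ Q (missWeight vs g) _ ⟩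
        missWeight vs g * Q + sum (map (missWeight vs) gs) * Q ≤⟨ +-mono-≤ (bound g (h (here refl))) (sum-bound gs (h ∘ there)) ⟩
        N + length gs * N                                      ∎

-- Inequalities between powers.

*-^-distrib : ∀ x y k → (x * y) ^ k ≡ x ^ k * y ^ k
*-^-distrib x y zero    = refl
*-^-distrib x y (suc k) rewrite *-^-distrib x y k = lemma x y (x ^ k) (y ^ k)
  where
  lemma : ∀ x y p q → x * y * (p * q) ≡ x * p * (y * q)
  lemma = solve-∀

-- For c ≥ 1 this is Bernoulli's inequality 1 + t/c ≤ (1 + 1/c)^t, cleared of denominators.
bernoulli : ∀ c t → c ^ t * (c + t) ≤ suc c ^ t * c
bernoulli c zero    = ≤-reflexive (cong (1 *_) (+-identityʳ c))
bernoulli c (suc t) = begin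
  c * c ^ t * (c + suc t)              ≡⟨ lemma₁ c (c ^ t) t ⟩
  c * (c ^ t * (c + t)) + c ^ t * c    ≤⟨ +-mono-≤ (*-monoʳ-≤ c (bernoulli c t)) (*-monoˡ-≤ c (^-monoˡ-≤ t (n≤1+n c))) ⟩
  c * (suc c ^ t * c) + suc c ^ t * c  ≡⟨ lemma₂ c (suc c ^ t) ⟩
  suc c * suc c ^ t * c                ∎
  where
  open ≤-Reasoning
  lemma₁ : ∀ c p t → c * p * (c + suc t) ≡ c * (p * (c + t)) + p * c
  lemma₁ = solve-∀
  lemma₂ : ∀ c p → c * (p * c) + p * c ≡ suc c * p * c
  lemma₂ = solve-∀

-- Bernoulli with t = q c gives (1 + 1/c)^(q c) ≥ 1 + q ≥ q; this is then raised to the power J.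
power-decay : ∀ c .{{_ : NonZero c}} q J → c ^ (q * c * J) * q ^ J ≤ suc c ^ (q * c * J)
power-decay c q J = begin
  c ^ (q * c * J) * q ^ J     ≡⟨ cong (_* q ^ J) (^-*-assoc c (q * c) J) ⟨
  (c ^ (q * c)) ^ J * q ^ J   ≡⟨ *-^-distrib (c ^ (q * c)) q J ⟨
  (c ^ (q * c) * q) ^ J       ≤⟨ ^-monoˡ-≤ J base ⟩
  (suc c ^ (q * c)) ^ J       ≡⟨ ^-*-assoc (suc c) (q * c) J ⟩
  suc c ^ (q * c * J)         ∎
  where
  open ≤-Reasoning
  base : c ^ (q * c) * q ≤ suc c ^ (q * c)
  base = *-cancelʳ-≤ _ _ c (begin
    c ^ (q * c) * q * c       ≡⟨ *-assoc (c ^ (q * c)) q c ⟩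
    c ^ (q * c) * (q * c)     ≤⟨ *-monoʳ-≤ (c ^ (q * c)) (m≤n+m (q * c) c) ⟩
    c ^ (q * c) * (c + q * c) ≤⟨ bernoulli c (q * c) ⟩
    suc c ^ (q * c) * c       ∎)

-- Sampling the alive elements.

module _ {n : ℕ} where
  open DecMembership (_≟ᶠ_ {n}) public using () renaming (_∈?_ to _∈ᶠ?_)

module Sampling {n : ℕ} where

  hits : List (Fin n) → List (Fin n) → ℕ
  hits U A = length (filter (_∈ᶠ? U) A)

  -- By its exponential weights, a potential below ρ ^ b forces fewer than b hits.
  potential : List (List (Fin n) × ℕ) → List (Fin n) → ℕ
  potential Es A = sum (map (λ (U , ρ) → ρ ^ hits U A) Es)

  -- Drawing j multiplies ρ ^ hits by ρ if j lies in U and by 1 otherwise.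
  sum-draws : ∀ U ρ A js → sum (map (λ j → ρ ^ hits U (j ∷ A)) js) ≤
                           ρ ^ hits U A * (length js + ρ * hits U js)
  sum-draws U ρ A []       = z≤n
  sum-draws U ρ A (j ∷ js) with j ∈ᶠ? U | sum-draws U ρ A js
  ... | yes _ | ih = ≤-trans (+-monoʳ-≤ (ρ * ρ ^ hits U A) ih)
                       (≤-trans (m≤n+m _ (ρ ^ hits U A)) (≤-reflexive (lemma ρ (ρ ^ hits U A) (length js) (hits U js))))
    where
    lemma : ∀ r p l h → p + (r * p + p * (l + r * h)) ≡ p * (suc l + r * suc h)
    lemma = solve-∀
  ... | no _  | ih = ≤-trans (+-monoʳ-≤ (ρ ^ hits U A) ih)
                       (≤-reflexive (lemma (ρ ^ hits U A) (length js) (ρ * hits U js)))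
    where
    lemma : ∀ p l h → p + p * (l + h) ≡ p * (suc l + h)
    lemma = solve-∀

  Sparse : List (List (Fin n) × ℕ) → Set
  Sparse Es = ∀ {U ρ} → (U , ρ) ∈ Es → ρ * length U ≤ n

  -- On average over a uniform draw, each term grows by a factor of at most 1 + ρ|U|/n, which
  -- sparseness bounds by 2.
  sum-potential : ∀ A Es → Sparse Es →
    sum (map (λ j → potential Es (j ∷ A)) (allFin n)) ≤ potential Es A * (n + n)
  sum-potential A []             _      = ≤-reflexive (sum-map-* 0 (λ _ → 0) (allFin n))
  sum-potential A ((U , ρ) ∷ Es) sparse = begin
    sum (map (λ j → ρ ^ hits U (j ∷ A) + potential Es (j ∷ A)) (allFin n))
      ≡⟨ sum-map-+ _ _ (allFin n) ⟩
    sum (map (λ j → ρ ^ hits U (j ∷ A)) (allFin n)) + sum (map (λ j → potential Es (j ∷ A)) (allFin n))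
      ≤⟨ +-mono-≤ (sum-draws U ρ A (allFin n)) (sum-potential A Es (sparse ∘ there)) ⟩
    ρ ^ hits U A * (length (allFin n) + ρ * hits U (allFin n)) + potential Es A * (n + n)
      ≤⟨ +-monoˡ-≤ _ (*-monoʳ-≤ (ρ ^ hits U A) (+-mono-≤ (≤-reflexive (length-tabulate {n = n} id))
           (≤-trans (*-monoʳ-≤ ρ hits≤) (sparse (here refl))))) ⟩
    ρ ^ hits U A * (n + n) + potential Es A * (n + n)
      ≡⟨ *-distribʳ-+ (n + n) (ρ ^ hits U A) (potential Es A) ⟨
    (ρ ^ hits U A + potential Es A) * (n + n) ∎
    where
    open ≤-Reasoning
    hits≤ : hits U (allFin n) ≤ length U
    hits≤ = Unique-⊆⇒length≤ (Unique.filter⁺ (_∈ᶠ? U) (Unique.allFin⁺ n))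
              (λ x∈ → proj₂ (∈-filter⁻ (_∈ᶠ? U) {xs = allFin n} x∈))

  -- At least half of the elements are allowed, so avoiding the bad ones at most doubles the mean
  -- factor 2.
  draw : ∀ A Es → Sparse Es → ∀ (bad : List (Fin n)) → 1 ≤ n → length bad + length bad ≤ n →
         ∃ λ j → j ∉ bad × potential Es (j ∷ A) ≤ potential Es A * 4
  draw A Es sparse bad 1≤n bad≤ = result (filter good? (allFin n)) refl
    where
    open ≤-Reasoning
    good? : Decidable (_∉ bad)
    good? j = ¬? (j ∈ᶠ? bad)
    f = λ j → potential Es (j ∷ A)
    n≤ : n ≤ length bad + length (filter good? (allFin n))
    n≤ = begin
      n                     ≡⟨ length-tabulate {n = n} id ⟨
      length (allFin n)     ≤⟨ Unique-⊆⇒length≤ (Unique.allFin⁺ n) cover ⟩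
      length (bad ++ filter good? (allFin n)) ≡⟨ length-++ bad ⟩
      length bad + length (filter good? (allFin n)) ∎
      where
      cover : allFin n ⊆ bad ++ filter good? (allFin n)
      cover {j} j∈ with j ∈ᶠ? bad
      ... | yes j∈bad = ∈-++⁺ˡ j∈bad
      ... | no  j∉bad = ∈-++⁺ʳ bad (∈-filter⁺ good? j∈ j∉bad)
    half : n ≤ length (filter good? (allFin n)) + length (filter good? (allFin n))
    half = +-cancelˡ-≤ n _ _ (begin
      n + n                     ≤⟨ +-mono-≤ n≤ n≤ ⟩
      (b + g) + (b + g)         ≡⟨ lemma b g ⟩
      (b + b) + (g + g)         ≤⟨ +-monoˡ-≤ (g + g) bad≤ ⟩
      n + (g + g)               ∎)
      where
      b = length bad
      g = length (filter good? (allFin n))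
      lemma : ∀ b g → (b + g) + (b + g) ≡ (b + b) + (g + g)
      lemma = solve-∀
    result : ∀ js → filter good? (allFin n) ≡ js → ∃ λ j → j ∉ bad × potential Es (j ∷ A) ≤ potential Es A * 4
    result [] eq = contradiction (subst (λ js → n ≤ length js + length js) eq half) (<⇒≱ 1≤n)
    result (j₀ ∷ js) eq =
      let (j , j∈ , fj≤) = ∃-below-average f (potential Es A * 4) j₀ js (subst (λ js → sum (map f js) ≤ length js * (potential Es A * 4)) eq avg)
      in j , proj₂ (∈-filter⁻ good? {xs = allFin n} (subst (j ∈_) (sym eq) j∈)) , fj≤
      where
      g = length (filter good? (allFin n))
      lemma : ∀ p g → p * ((g + g) + (g + g)) ≡ g * (p * 4)
      lemma = solve-∀
      avg : sum (map f (filter good? (allFin n))) ≤ g * (potential Es A * 4)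
      avg = begin
        sum (map f (filter good? (allFin n))) ≤⟨ sum-map-filter-≤ good? f (allFin n) ⟩
        sum (map f (allFin n))                ≤⟨ sum-potential A Es sparse ⟩
        potential Es A * (n + n)              ≤⟨ *-monoʳ-≤ (potential Es A) (+-mono-≤ half half) ⟩
        potential Es A * ((g + g) + (g + g))  ≡⟨ lemma (potential Es A) g ⟩
        g * (potential Es A * 4)              ∎

  -- Before the first draw every term is 1. Each of the m draws avoids o and the elements already
  -- drawn, and costs a factor 4.
  sample : ∀ Es → Sparse Es → 1 ≤ n → ∀ o m → (1 + m) + (1 + m) ≤ n →
           ∃ λ A → Unique (o ∷ A) × length A ≡ m × potential Es A ≤ length Es * 4 ^ m
  sample Es sparse 1≤n o zero    _  = [] , ([] ∷ []) , refl , ≤-reflexive (potential-[] Es)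
    where
    potential-[] : ∀ Es → potential Es [] ≡ length Es * 1
    potential-[] []       = refl
    potential-[] (_ ∷ Es) = cong suc (potential-[] Es)
  sample Es sparse 1≤n o (suc m) m< with sample Es sparse 1≤n o m (≤-trans (+-mono-≤ (n≤1+n (suc m)) (n≤1+n (suc m))) m<)
  ... | A , uoA@(o∉A ∷ uA) , refl , ≤pot with draw A Es sparse (o ∷ A) 1≤n (≤-trans (+-mono-≤ (n≤1+n (suc (length A))) (n≤1+n (suc (length A)))) m<)
  ... | j , j∉ , pot≤ = j ∷ A
      , ((λ o≡j → j∉ (here (sym o≡j))) ∷ o∉A) ∷ (All.tabulate (λ x∈ j≡x → j∉ (there (subst (_∈ A) (sym j≡x) x∈))) ∷ uA)
      , refl
      , (begin
          potential Es (j ∷ A)            ≤⟨ pot≤ ⟩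
          potential Es A * 4              ≤⟨ *-monoˡ-≤ 4 ≤pot ⟩
          length Es * 4 ^ length A * 4    ≡⟨ lemma (length Es) (4 ^ length A) ⟩
          length Es * (4 * 4 ^ length A)  ∎)
    where
    open ≤-Reasoning
    lemma : ∀ l p → l * p * 4 ≡ l * (4 * p)
    lemma = solve-∀

-- Clauses and the variables of RLNP.

does⇒ : ∀ {P : Set} (P? : Dec P) → does P? ≡ true → P
does⇒ (yes p) _ = p

true≢false : ∀ {b} → b ≡ true → b ≡ false → ∀ {P : Set} → P
true≢false refl ()

variableOf : Literal V → V
variableOf (pos x) = x
variableOf (neg x) = x

sign : Literal V → Bool
sign (pos _) = true
sign (neg _) = false

literal : Bool → V → Literal V
literal true  = pos
literal false = neg

≋[]⇒∉ : ∀ {C : Clause V} {ℓ} {P : Set} → C ≋ [] → ℓ ∈ C → P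
≋[]⇒∉ C≋[] ℓ∈ with () ← Equivalence.to C≋[] ℓ∈

Falsifies : (V → Bool) → Clause V → Set
Falsifies v C = ∀ {ℓ} → ℓ ∈ C → v (variableOf ℓ) ≡ not (sign ℓ)

infix 4 _≟ⱽ_
_≟ⱽ_ : DecidableEquality (Var n)
R i   ≟ⱽ R j   = map′ (cong R) (λ { refl → refl }) (i ≟ᶠ j)
R _   ≟ⱽ L _ _ = no λ ()
R _   ≟ⱽ S _ _ = no λ ()
L _ _ ≟ⱽ R _   = no λ ()
L i j ≟ⱽ L k l = map′ (λ { (refl , refl) → refl }) (λ { refl → refl , refl })
                   ((i ≟ᶠ k) ×-dec (j ≟ᶠ l))
L _ _ ≟ⱽ S _ _ = no λ ()
S _ _ ≟ⱽ R _   = no λ ()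
S _ _ ≟ⱽ L _ _ = no λ ()
S i j ≟ⱽ S k l = map′ (λ { (refl , refl) → refl }) (λ { refl → refl , refl })
                   ((i ≟ᶠ k) ×-dec (j ≟ᶠ l))

infix 4 _≟ᴸ_
_≟ᴸ_ : DecidableEquality (Literal (Var n))
pos x ≟ᴸ pos y = map′ (cong pos) (λ { refl → refl }) (x ≟ⱽ y)
pos _ ≟ᴸ neg _ = no λ ()
neg _ ≟ᴸ pos _ = no λ ()
neg x ≟ᴸ neg y = map′ (cong neg) (λ { refl → refl }) (x ≟ⱽ y)

module _ {n : ℕ} where
  open DecMembership (_≟ᴸ_ {n}) public using () renaming (_∈?_ to _∈ᴸ?_)

allVars : ∀ n → List (Var n)
allVars n = map R (allFin n) ++ cartesianProductWith L (allFin n) (allFin n)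
                            ++ cartesianProductWith S (allFin n) (allFin n)

∈-allVars : ∀ (x : Var n) → x ∈ allVars n
∈-allVars {n} (R i)   = ∈-++⁺ˡ (∈-map⁺ R (∈-allFin i))
∈-allVars {n} (L i j) = ∈-++⁺ʳ (map R (allFin n)) (∈-++⁺ˡ (∈-cartesianProductWith⁺ L (∈-allFin i) (∈-allFin j)))
∈-allVars {n} (S i j) = ∈-++⁺ʳ (map R (allFin n)) (∈-++⁺ʳ (cartesianProductWith L (allFin n) (allFin n))
                          (∈-cartesianProductWith⁺ S (∈-allFin i) (∈-allFin j)))

allVars-unique : ∀ n → Unique (allVars n)
allVars-unique n = Unique.++⁺ (Unique.map⁺ (λ { refl → refl }) u)
  (Unique.++⁺ (Unique.cartesianProductWith⁺ L (λ { refl → refl , refl }) u u)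
              (Unique.cartesianProductWith⁺ S (λ { refl → refl , refl }) u u) disjoint₂) disjoint₁
  where
  u = Unique.allFin⁺ n
  disjoint₂ : ∀ {x} → ¬ (x ∈ cartesianProductWith L (allFin n) (allFin n) ×
                         x ∈ cartesianProductWith S (allFin n) (allFin n))
  disjoint₂ (p , q) with ∈-cartesianProductWith⁻ L (allFin n) (allFin n) p
                       | ∈-cartesianProductWith⁻ S (allFin n) (allFin n) q
  ... | _ , _ , _ , _ , refl | _ , _ , _ , _ , ()
  disjoint₁ : ∀ {x} → ¬ (x ∈ map R (allFin n) × x ∈ cartesianProductWith L (allFin n) (allFin n)
                                               ++ cartesianProductWith S (allFin n) (allFin n))
  disjoint₁ (p , q) with ∈-map⁻ R p | ∈-++⁻ (cartesianProductWith L (allFin n) (allFin n)) q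
  ... | _ , _ , refl | inj₁ q′ with ∈-cartesianProductWith⁻ L (allFin n) (allFin n) q′
  ...   | _ , _ , _ , _ , ()
  disjoint₁ (p , q) | _ , _ , refl | inj₂ q′ with ∈-cartesianProductWith⁻ S (allFin n) (allFin n) q′
  ...   | _ , _ , _ , _ , ()

-- Changing the least element z of the order only affects the variables that
-- mention z; for S i j this is the case only if z = j.
mentions : Var n → List (Fin n)
mentions (R _)   = []
mentions (L i j) = i ∷ j ∷ []
mentions (S _ j) = j ∷ []

endpoints : Var n → List (Fin n)
endpoints (R i)   = i ∷ []
endpoints (L i j) = i ∷ j ∷ []
endpoints (S i j) = i ∷ j ∷ []

length-mentions : ∀ (x : Var n) → length (mentions x) ≤ 2
length-mentions (R _)   = z≤n
length-mentions (L _ _) = s≤s (s≤s z≤n)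
length-mentions (S _ _) = s≤s z≤n

length-endpoints : ∀ (x : Var n) → length (endpoints x) ≤ 2
length-endpoints (R _)   = s≤s z≤n
length-endpoints (L _ _) = s≤s (s≤s z≤n)
length-endpoints (S _ _) = s≤s (s≤s z≤n)

Mentions : Clause (Var n) → Fin n → Set
Mentions C z = Any (λ ℓ → z ∈ mentions (variableOf ℓ)) C

Mentions? : ∀ (C : Clause (Var n)) → Decidable (Mentions C)
Mentions? C z = any? (λ ℓ → z ∈ᶠ? mentions (variableOf ℓ)) C

mentioned : Clause (Var n) → List (Fin n)
mentioned {n} C = filter (Mentions? C) (allFin n)

-- Filtering all variables, rather than the clause, counts a repeated literal once.
negated : Clause (Var n) → List (Var n)
negated {n} C = filter (λ x → neg x ∈ᴸ? C) (allVars n)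

-- Alive elements, orders on them, and random variables.

module Critical {n : ℕ} (top : Fin n) (As : List (Fin n)) where

  alive : List (Fin n)
  alive = top ∷ As

  -- Elements are compared by rank, and equal ranks are incomparable: RLNP has no totality clause.
  -- `below j` is the witness of j; `least` gets none.
  record Order : Set where
    field
      least       : Fin n
      rank        : Fin n → ℕ
      below       : Fin n → Fin n
      below-alive : ∀ {j} → j ∈ alive → j ≢ least → below j ∈ alive
      below-rank  : ∀ {j} → j ∈ alive → j ≢ least → rank (below j) < rank j
  open Order

  Random : Var n → Set
  Random (R _)   = ⊥
  Random (L i j) = ¬ (i ∈ alive × j ∈ alive)
  Random (S _ j) = j ∉ alive

  random? : Decidable Random
  random? (R _)   = no λ ()
  random? (L i j) = ¬? ((i ∈ᶠ? alive) ×-dec (j ∈ᶠ? alive))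
  random? (S _ j) = ¬? (j ∈ᶠ? alive)

  topOrder : Order
  topOrder = record
    { least = top
    ; rank = rank₀
    ; below = λ _ → top
    ; below-alive = λ _ _ → here refl
    ; below-rank = λ {j} _ j≢ → subst₂ _<_ (sym rank-top) (sym (rank-other j j≢)) (s≤s z≤n)
    }
    where
    rank₀ : Fin n → ℕ
    rank₀ j = if does (j ≟ᶠ top) then 0 else 1
    rank-top : rank₀ top ≡ 0
    rank-top rewrite dec-true (top ≟ᶠ top) refl = refl
    rank-other : ∀ j → j ≢ top → rank₀ j ≡ 1
    rank-other j j≢ rewrite dec-false (j ≟ᶠ top) j≢ = refl

  -- No order makes L i i or S i i true for an alive i, so these are left out; on u + 1 distinct
  -- elements (u + 1)(1 + 2u) variables remain.
  loopless : List (Fin n) → List (Var n)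
  loopless B = concatMap (λ i → R i ∷ map (L i) (others i) ++ map (S i) (others i)) B
    where
    others = λ i → filter (λ j → ¬? (i ≟ᶠ j)) B

  length-loopless : ∀ B u → length B ≤ suc u → length (loopless B) ≤ suc u * suc (u + u)
  length-loopless B u B≤ = ≤-trans (length-concatMap-≤ _ (suc (u + u)) B bound) (*-monoˡ-≤ (suc (u + u)) B≤)
    where
    open ≤-Reasoning
    bound : ∀ {i} → i ∈ B → _
    bound {i} i∈ = s≤s (begin
      length (map (L i) others ++ map (S i) others)            ≡⟨ length-++ (map (L i) others) ⟩
      length (map (L i) others) + length (map (S i) others)    ≡⟨ cong₂ _+_ (length-map (L i) others) (length-map (S i) others) ⟩
      length others + length others                            ≤⟨ +-mono-≤ others≤ others≤ ⟩
      u + u                                                    ∎)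
      where
      others = filter (λ j → ¬? (i ≟ᶠ j)) B
      others≤ : length others ≤ u
      others≤ = s≤s⁻¹ (≤-trans (filter-notAll _ B (Any.map (λ { refl ¬¬ → ¬¬ refl }) i∈)) B≤)

  -- The part of C on random variables. If x occurs with both signs the negative one wins, so that
  -- `falseTargeted` counts every negated random variable.
  target : Clause (Var n) → Var n → Maybe Bool
  target C x with random? x
  ... | no _ = nothing
  ... | yes _ with neg x ∈ᴸ? C
  ...   | yes _ = just false
  ...   | no _ with pos x ∈ᴸ? C
  ...     | yes _ = just true
  ...     | no _  = nothing

  target-sound : ∀ C x {b} → target C x ≡ just b → Random x × literal b x ∈ C
  target-sound C x eq with random? x
  target-sound C x () | no _
  ... | yes r with neg x ∈ᴸ? C
  target-sound C x refl | yes r | yes n∈ = r , n∈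
  ...   | no _ with pos x ∈ᴸ? C
  target-sound C x refl | yes r | no _ | yes p∈ = r , p∈
  target-sound C x ()   | yes r | no _ | no _

  target-neg : ∀ C x → Random x → neg x ∈ C → target C x ≡ just false
  target-neg C x r n∈ with random? x
  ... | no ¬r = contradiction r ¬r
  ... | yes _ with neg x ∈ᴸ? C
  ...   | yes _ = refl
  ...   | no n∉ = contradiction n∈ n∉

  target-∈ : ∀ C {ℓ} → Random (variableOf ℓ) → ℓ ∈ C → target C (variableOf ℓ) ≢ nothing
  target-∈ C {neg x} r ℓ∈ eq with () ← trans (sym (target-neg C x r ℓ∈)) eq
  target-∈ C {pos x} r ℓ∈ eq with random? x
  ... | no ¬r = contradiction r ¬r
  ... | yes _ with neg x ∈ᴸ? C
  target-∈ C {pos x} r ℓ∈ () | yes _ | yes _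
  ...   | no _ with pos x ∈ᴸ? C
  target-∈ C {pos x} r ℓ∈ () | yes _ | no _ | yes _
  ...     | no p∉ = contradiction ℓ∈ p∉

  open Conditioning (_≟ⱽ_ {n})

  randomVars randomNegated : Clause (Var n) → List (Var n)
  randomVars C    = targeted (allVars n) (target C)
  randomNegated C = falseTargeted (allVars n) (target C)

  ∈-randomVars : ∀ C {ℓ} → Random (variableOf ℓ) → ℓ ∈ C → variableOf ℓ ∈ randomVars C
  ∈-randomVars C {ℓ} r ℓ∈ = ∈-filter⁺ (λ x → ¬? (target C x ≟ᴹ nothing)) (∈-allVars (variableOf ℓ)) (target-∈ C r ℓ∈)

  -- A dead element is mentioned by random variables only, and a variable mentions at most two
  -- elements.
  mentioned-bound : ∀ C → length (mentioned C) ≤ suc (length As) + length (randomVars C) * 2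
  mentioned-bound C = begin
    length (mentioned C)                                        ≤⟨ Unique-⊆⇒length≤ (Unique.filter⁺ (Mentions? C) (Unique.allFin⁺ n)) cover ⟩
    length (alive ++ concatMap mentions (randomVars C))         ≡⟨ length-++ alive ⟩
    suc (length As) + length (concatMap mentions (randomVars C)) ≤⟨ +-monoʳ-≤ (suc (length As)) (length-concatMap-≤ mentions 2 (randomVars C) (λ {x} _ → length-mentions x)) ⟩
    suc (length As) + length (randomVars C) * 2                 ∎
    where
    open ≤-Reasoning
    dead-random : ∀ {z} x → z ∉ alive → z ∈ mentions x → Random x
    dead-random (L i j) z∉ (here refl)         = z∉ ∘ proj₁
    dead-random (L i j) z∉ (there (here refl)) = z∉ ∘ proj₂
    dead-random (S i j) z∉ (here refl)         = z∉
    cover : mentioned C ⊆ alive ++ concatMap mentions (randomVars C)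
    cover {z} z∈ with z ∈ᶠ? alive
    ... | yes z∈alive = ∈-++⁺ˡ z∈alive
    ... | no  z∉alive with find (proj₂ (∈-filter⁻ (Mentions? C) {xs = allFin n} z∈))
    ...   | ℓ , ℓ∈ , z∈ℓ = ∈-++⁺ʳ alive (∈-concatMap mentions
              (∈-randomVars C (dead-random (variableOf ℓ) z∉alive z∈ℓ) ℓ∈) z∈ℓ)

  -- All variables S i j with j dead are random, and at most one of them is supplied by ℓ instead of
  -- C.
  column-bound : ∀ {C ℓ j} → j ∉ alive → (∀ i → pos (S i j) ∈ ℓ ∷ C) → n ≤ suc (length (randomVars C))
  column-bound {C} {ℓ} {j} j∉ ∈ℓC = begin
    n                                         ≡⟨ length-tabulate {n = n} id ⟨
    length (allFin n)                         ≡⟨ length-map (λ i → S i j) (allFin n) ⟨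
    length (map (λ i → S i j) (allFin n))     ≤⟨ Unique-⊆⇒length≤ (Unique.map⁺ (λ { refl → refl }) (Unique.allFin⁺ n)) cover ⟩
    suc (length (randomVars C))               ∎
    where
    open ≤-Reasoning
    cover : map (λ i → S i j) (allFin n) ⊆ variableOf ℓ ∷ randomVars C
    cover x∈ with ∈-map⁻ (λ i → S i j) x∈
    ... | i , _ , refl with ∈ℓC i
    ...   | here refl  = here refl
    ...   | there p∈   = there (∈-randomVars C j∉ p∈)

  open Sampling using (hits)

  -- At most 2 elements of `As` are lost to x, and `hits (mentioned C) As` of them to C.
  fresh : ∀ C x → 2 + hits (mentioned C) As < length As → Unique As →
          ∃ λ z → z ∈ As × ¬ Mentions C z × z ∉ mentions x
  fresh C x few unique with any? (λ z → ¬? (Mentions? C z) ×-dec ¬? (z ∈ᶠ? mentions x)) As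
  ... | yes p = let (z , z∈ , q) = find p in z , z∈ , q
  ... | no ¬p = contradiction few (≤⇒≯ (begin
    length As                                                     ≤⟨ Unique-⊆⇒length≤ unique cover ⟩
    length (mentions x ++ filter (_∈ᶠ? mentioned C) As)           ≡⟨ length-++ (mentions x) ⟩
    length (mentions x) + hits (mentioned C) As                   ≤⟨ +-monoˡ-≤ _ (length-mentions x) ⟩
    2 + hits (mentioned C) As                                     ∎))
    where
    open ≤-Reasoning
    cover : As ⊆ mentions x ++ filter (_∈ᶠ? mentioned C) As
    cover {z} z∈ with z ∈ᶠ? mentions x | Mentions? C z
    ... | yes z∈x | _      = ∈-++⁺ˡ z∈x
    ... | no _    | yes mC = ∈-++⁺ʳ (mentions x) (∈-filter⁺ (_∈ᶠ? mentioned C) z∈ (∈-filter⁺ (Mentions? C) (∈-allFin z) mC))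
    ... | no z∉x  | no ¬mC = contradiction (lose z∈ (¬mC , z∉x)) ¬p

  -- Assignments given by an order and the random values.

  module Assignments (M : Var n → Bool) where

    value : Order → Var n → Bool
    value o (R i)   = does (i ∈ᶠ? alive)
    value o (L i j) = if does ((i ∈ᶠ? alive) ×-dec (j ∈ᶠ? alive))
                      then does (rank o i <? rank o j) else M (L i j)
    value o (S i j) = if does (j ∈ᶠ? alive)
                      then does (¬? (j ≟ᶠ least o) ×-dec (i ≟ᶠ below o j)) else M (S i j)

    value-random : ∀ o x → Random x → value o x ≡ M x
    value-random o (L i j) r rewrite dec-false ((i ∈ᶠ? alive) ×-dec (j ∈ᶠ? alive)) r = refl
    value-random o (S i j) r rewrite dec-false (j ∈ᶠ? alive) r = refl

    R-true⁻ : ∀ o {i} → value o (R i) ≡ true → i ∈ alive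
    R-true⁻ o {i} = does⇒ (i ∈ᶠ? alive)

    R-true⁺ : ∀ o {i} → i ∈ alive → value o (R i) ≡ true
    R-true⁺ o {i} = dec-true (i ∈ᶠ? alive)

    L-true⁻ : ∀ o {i j} → i ∈ alive → j ∈ alive → value o (L i j) ≡ true → rank o i < rank o j
    L-true⁻ o {i} {j} i∈ j∈ eq rewrite dec-true ((i ∈ᶠ? alive) ×-dec (j ∈ᶠ? alive)) (i∈ , j∈) =
      does⇒ (rank o i <? rank o j) eq

    L-true⁺ : ∀ o {i j} → i ∈ alive → j ∈ alive → rank o i < rank o j → value o (L i j) ≡ true
    L-true⁺ o {i} {j} i∈ j∈ lt rewrite dec-true ((i ∈ᶠ? alive) ×-dec (j ∈ᶠ? alive)) (i∈ , j∈) =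
      dec-true (rank o i <? rank o j) lt

    S-true⁻ : ∀ o {i j} → j ∈ alive → value o (S i j) ≡ true → j ≢ least o × i ≡ below o j
    S-true⁻ o {i} {j} j∈ eq rewrite dec-true (j ∈ᶠ? alive) j∈ =
      does⇒ (¬? (j ≟ᶠ least o) ×-dec (i ≟ᶠ below o j)) eq

    S-true⁺ : ∀ o {j} → j ∈ alive → j ≢ least o → value o (S (below o j) j) ≡ true
    S-true⁺ o {j} j∈ j≢ rewrite dec-true (j ∈ᶠ? alive) j∈ =
      dec-true (¬? (j ≟ᶠ least o) ×-dec (below o j ≟ᶠ below o j)) (j≢ , refl)

    module _ (o : Order) (z : Fin n) where

      newRank : Fin n → ℕ
      newRank j = if does (j ≟ᶠ z) then 0 else suc (rank o j)

      newBelow : Fin n → Fin n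
      newBelow j = if does (j ≟ᶠ least o) then z else below o j

      newRank-z : newRank z ≡ 0
      newRank-z rewrite dec-true (z ≟ᶠ z) refl = refl

      newRank-≢ : ∀ {j} → j ≢ z → newRank j ≡ suc (rank o j)
      newRank-≢ {j} j≢ rewrite dec-false (j ≟ᶠ z) j≢ = refl

      newRank-≤ : ∀ j → newRank j ≤ suc (rank o j)
      newRank-≤ j with does (j ≟ᶠ z)
      ... | true  = z≤n
      ... | false = ≤-refl

      newBelow-≢ : ∀ {j} → j ≢ least o → newBelow j ≡ below o j
      newBelow-≢ {j} j≢ rewrite dec-false (j ≟ᶠ least o) j≢ = refl

      -- The other ranks move up by one to make room for z at rank 0.
      rebase : z ∈ alive → Order
      rebase z∈ = record
        { least = z
        ; rank = newRank
        ; below = newBelow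
        ; below-alive = newBelow-alive
        ; below-rank = newBelow-rank
        }
        where
        newBelow-alive : ∀ {j} → j ∈ alive → j ≢ z → newBelow j ∈ alive
        newBelow-alive {j} j∈ j≢z with j ≟ᶠ least o
        ... | yes _  = z∈
        ... | no  j≢ = below-alive o j∈ j≢
        newBelow-rank : ∀ {j} → j ∈ alive → j ≢ z → newRank (newBelow j) < newRank j
        newBelow-rank {j} j∈ j≢z rewrite newRank-≢ j≢z with j ≟ᶠ least o
        ... | yes _  rewrite newRank-z = s≤s z≤n
        -- `below o j` may be z, whose rank has dropped to 0; hence only an upper bound on its new
        -- rank is used.
        ... | no  j≢ = s≤s (≤-trans (newRank-≤ (below o j)) (below-rank o j∈ j≢))

      -- Elements other than z keep their mutual order, and witnesses change only for the old least
      -- element and for z.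
      rebase-value : ∀ z∈ x → least o ∉ mentions x → z ∉ mentions x →
                     value (rebase z∈) x ≡ value o x
      rebase-value z∈ (R i)   _ _ = refl
      rebase-value z∈ (L i j) _ z∉
        rewrite newRank-≢ {i} (λ { refl → z∉ (here refl) })
              | newRank-≢ {j} (λ { refl → z∉ (there (here refl)) }) = refl
      rebase-value z∈ (S i j) l∉ z∉
        rewrite newBelow-≢ {j} (λ { refl → l∉ (here refl) })
              | dec-false (j ≟ᶠ z) (λ { refl → z∉ (here refl) })
              | dec-false (j ≟ᶠ least o) (λ { refl → l∉ (here refl) }) = refl

    -- What is left is the witness clause of a dead j, on random variables only. For an alive j the
    -- literal S (below j) j is true, unless j is least, and then the clause mentions it.
    falsified-RLNP : (∀ i → suc (toℕ i) ≡ n → i ≡ top) → ∀ o {D} → RLNP n D →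
      Falsifies (value o) D → ¬ Mentions D (least o) →
      ∃ λ j → j ∉ alive × (∀ i → pos (S i j) ∈ D)
    falsified-RLNP _ o (irreflexive i) f _ =
      contradiction (L-true⁻ o i∈ i∈ (f (there (here refl)))) (<-irrefl refl)
      where
      i∈ = R-true⁻ o (f (here refl))
    falsified-RLNP _ o (transitive i j l) f _ =
      true≢false (L-true⁺ o i∈ l∈ (<-trans (L-true⁻ o i∈ j∈ (f (there (there (there (here refl))))))
                                           (L-true⁻ o j∈ l∈ (f (there (there (there (there (here refl)))))))))
                 (f (there (there (there (there (there (here refl)))))))
      where
      i∈ = R-true⁻ o (f (here refl))
      j∈ = R-true⁻ o (f (there (here refl)))
      l∈ = R-true⁻ o (f (there (there (here refl))))
    falsified-RLNP _ o (witness j) f unmentioned with j ∈ᶠ? alive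
    ... | no  j∉ = j , j∉ , λ i → ∈-map⁺ (λ i → pos (S i j)) (∈-allFin i)
    ... | yes j∈ with j ≟ᶠ least o
    ...   | yes refl = contradiction (lose (∈-map⁺ (λ i → pos (S i j)) (∈-allFin j)) (here refl)) unmentioned
    ...   | no  j≢   = true≢false (S-true⁺ o j∈ j≢) (f (∈-map⁺ (λ i → pos (S i j)) (∈-allFin (below o j))))
    falsified-RLNP _ o (witness-R i j) f _
      with R-true⁻ o (f (there (here refl)))
    ... | j∈ with S-true⁻ o j∈ (f (here refl))
    ... | j≢ , refl = true≢false (R-true⁺ o (below-alive o j∈ j≢)) (f (there (there (here refl))))
    falsified-RLNP _ o (witness-L i j) f _
      with R-true⁻ o (f (there (here refl)))
    ... | j∈ with S-true⁻ o j∈ (f (here refl))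
    ... | j≢ , refl = true≢false (L-true⁺ o (below-alive o j∈ j≢) j∈ (below-rank o j∈ j≢)) (f (there (there (here refl))))
    falsified-RLNP isTop o (last-R i eq) f _ =
      true≢false (R-true⁺ o (subst (_∈ alive) (sym (isTop i eq)) (here refl))) (f (here refl))

    -- In a true S i j with j alive, i is the witness of j and hence alive too. That ranks strictly
    -- increase excludes i = j.
    alive-true : ∀ o B x → (∀ {i} → i ∈ alive → i ∈ endpoints x → i ∈ B) →
                 ¬ Random x → value o x ≡ true → x ∈ loopless B
    alive-true o B (R i) ∈B _ t = ∈-concatMap _ (∈B (R-true⁻ o t) (here refl)) (here refl)
    alive-true o B (L i j) ∈B ¬r t with i ∈ᶠ? alive | j ∈ᶠ? alive
    ... | no i∉  | _      = contradiction (i∉ ∘ proj₁) ¬r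
    ... | yes _  | no j∉  = contradiction (j∉ ∘ proj₂) ¬r
    ... | yes i∈ | yes j∈ = ∈-concatMap _ (∈B i∈ (here refl)) (there (∈-++⁺ˡ (∈-map⁺ (L i)
            (∈-filter⁺ (λ j → ¬? (i ≟ᶠ j)) (∈B j∈ (there (here refl)))
              λ i≡j → <-irrefl (cong (rank o) i≡j) (L-true⁻ o i∈ j∈ t)))))
    alive-true o B (S i j) ∈B ¬r t with j ∈ᶠ? alive
    ... | no j∉  = contradiction j∉ ¬r
    ... | yes j∈ with S-true⁻ o j∈ t
    ...   | j≢ , refl = ∈-concatMap _ (∈B (below-alive o j∈ j≢) (here refl))
              (there (∈-++⁺ʳ (map (L i) others) (∈-map⁺ (S i) (∈-filter⁺ (λ j → ¬? (i ≟ᶠ j)) (∈B j∈ (there (here refl)))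
                λ i≡j → <-irrefl (cong (rank o) i≡j) (below-rank o j∈ j≢)))))
              where others = filter (λ j → ¬? (i ≟ᶠ j)) B

    falsified⇒¬meets : ∀ o {C} → Falsifies (value o) C → ¬ Meets (allVars n) M (target C)
    falsified⇒¬meets o {C} f (x , _ , eq) with M x in Mx | target-sound C x eq
    ... | true  | r , ℓ∈ = true≢false (trans (value-random o x r) Mx) (f ℓ∈)
    ... | false | r , ℓ∈ = true≢false (f ℓ∈) (trans (value-random o x r) Mx)

    -- At most (u+1)(2u+1) of the k chosen variables can be true because of their
    -- u+1 alive endpoints; the others are random.
    falsified-negated : ∀ o {C} k u → Falsifies (value o) C → k ≤ length (negated C) →
      hits (concatMap endpoints (take k (negated C))) As ≤ u →
      k ≤ suc u * suc (u + u) + length (randomNegated C)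
    falsified-negated o {C} k u f k≤ hits≤ = begin
      k                                               ≡⟨ m≤n⇒m⊓n≡m k≤ ⟨
      k ⊓ length (negated C)                          ≡⟨ length-take k (negated C) ⟨
      length (take k (negated C))                     ≤⟨ Unique-⊆⇒length≤ (Unique.take⁺ k (Unique.filter⁺ (λ x → neg x ∈ᴸ? C) (allVars-unique n))) cover ⟩
      length (loopless B ++ randomNegated C)          ≡⟨ length-++ (loopless B) ⟩
      length (loopless B) + length (randomNegated C)  ≤⟨ +-monoˡ-≤ _ (length-loopless B u B≤) ⟩
      suc u * suc (u + u) + length (randomNegated C)  ∎
      where
      open ≤-Reasoning
      U = concatMap endpoints (take k (negated C))
      B = filter (_∈ᶠ? U) alive
      -- `hits` counts elements of `As`; `top` may add one more.
      B≤ : length B ≤ suc u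
      B≤ with top ∈ᶠ? U
      ... | yes _ = s≤s hits≤
      ... | no _  = m≤n⇒m≤1+n hits≤
      cover : take k (negated C) ⊆ loopless B ++ randomNegated C
      cover {x} x∈ with random? x
      ... | yes r = ∈-++⁺ʳ (loopless B) (∈-filter⁺ (λ x → target C x ≟ᴹ just false) (∈-allVars x) (target-neg C x r n∈))
        where n∈ = proj₂ (∈-filter⁻ (λ x → neg x ∈ᴸ? C) {xs = allVars n} (take-⊆ k (negated C) x∈))
      ... | no ¬r = ∈-++⁺ˡ (alive-true o B x (λ i∈ i∈x → ∈-filter⁺ (_∈ᶠ? U) i∈ (∈-concatMap endpoints x∈ i∈x)) ¬r (f n∈))
        where n∈ = proj₂ (∈-filter⁻ (λ x → neg x ∈ᴸ? C) {xs = allVars n} (take-⊆ k (negated C) x∈))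

-- Of the k + 1 negated variables of the axiom at most one comes from ℓ.
weight-negated : ∀ {k D ℓ} (C : Clause (Var n)) → WeightAxiom k D → D ⊆ ℓ ∷ C → k ≤ length (negated C)
weight-negated {n} {k} {ℓ = ℓ} C (xs , unique , len , refl) D⊆ = s≤s⁻¹ (begin
  suc k                   ≡⟨ len ⟨
  length xs               ≤⟨ Unique-⊆⇒length≤ unique cover ⟩
  suc (length (negated C)) ∎)
  where
  open ≤-Reasoning
  cover : xs ⊆ variableOf ℓ ∷ negated C
  cover {x} x∈ with D⊆ (∈-map⁺ neg x∈)
  ... | here refl = here refl
  ... | there n∈  = there (∈-filter⁺ (λ x → neg x ∈ᴸ? C) (∈-allVars x) n∈)

-- The descent through the refutation.

module Walk {n k : ℕ} (π : p-Res₁-Refutation (RLNP n) k) (top : Fin n) (As : List (Fin n)) (M : Var n → Bool) where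
  open Critical top As
  open Assignments M
  open Order
  open Refutation π hiding (size)

  Falsified : Order → Fin (size π) → Set
  Falsified o i = Falsifies (value o) (line i)

  module _
    (fresh-in : ∀ i o → Falsified o i → ∀ x → ∃ λ z → z ∈ alive × ¬ Mentions (line i) z × z ∉ mentions x)
    (no-axiom : ∀ i o ℓ D → Falsified o i → (RLNP n D ⊎ WeightAxiom k D) → D ⊆ ℓ ∷ line i →
                Falsifies (value o) D → ¬ Mentions D (least o) → ⊥)
    where

    -- The negation of the invariant of the descent: the current line is falsified and does not
    -- mention the least element.
    Unvisited : Fin (size π) → Set
    Unvisited i = ∀ o → Falsified o i → ¬ Mentions (line i) (least o) → ⊥

    -- A premise is contained in its conclusion plus one literal. An axiom is refuted through this
    -- conclusion, because the random choices control the lines of π and not the axioms.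
    premise-contradiction : ∀ i → (∀ {j} → j <ᶠ i → Unvisited j) → ∀ o ℓ ν →
      (∀ j → ν ≡ inj₂ j → j <ᶠ i) → label ν ⊆ ℓ ∷ line i →
      Falsifies (value o) (ℓ ∷ line i) → ¬ Mentions (ℓ ∷ line i) (least o) → ⊥
    premise-contradiction i ih o ℓ (inj₁ (D , ax)) _ D⊆ f ¬m =
      no-axiom i o ℓ D (f ∘ there) ax D⊆ (f ∘ D⊆) (¬m ∘ Any-resp-⊆ D⊆)
    premise-contradiction i ih o ℓ (inj₂ j) j< D⊆ f ¬m = ih (j< j refl) o (f ∘ D⊆) (¬m ∘ Any-resp-⊆ D⊆)

    ∷-falsified : ∀ o {i} ℓ → value o (variableOf ℓ) ≡ not (sign ℓ) → Falsified o i → Falsifies (value o) (ℓ ∷ line i)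
    ∷-falsified o ℓ eq f (here refl) = eq
    ∷-falsified o ℓ eq f (there ℓ∈)  = f ℓ∈

    ∷-unmentioned : ∀ {C : Clause (Var n)} {z} ℓ → z ∉ mentions (variableOf ℓ) → ¬ Mentions C z → ¬ Mentions (ℓ ∷ C) z
    ∷-unmentioned ℓ z∉ ¬m (here z∈) = z∉ z∈
    ∷-unmentioned ℓ z∉ ¬m (there m) = ¬m m

    unvisited : ∀ i → Acc _<ᶠ_ i → Unvisited i
    unvisited i (acc rs) o f ¬m with step i | acyclic i
    -- The literal ℓ already belongs to the line, so the order can be kept.
    ... | weakening ℓ a C≋ | premise< = premise-contradiction i ih o ℓ a
          (λ { j refl → premise< j (here refl) }) (λ ∈a → there (Equivalence.from C≋ (there ∈a)))
          (∷-falsified o ℓ (f ℓ∈) f) (∷-unmentioned ℓ (λ z∈ → ¬m (lose ℓ∈ z∈)) ¬m)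
      where
      ih : ∀ {j} → j <ᶠ i → Unvisited j
      ih j<i = unvisited _ (rs j<i)
      ℓ∈ = Equivalence.from C≋ (here refl)
    ... | resolution {P} {Q} x a b a≋ b≋ C≋ | premise< with fresh-in i o f x
    -- Neither z nor the old least element is mentioned by the line, so the new order still
    -- falsifies it. As x does not mention z either, the invariant holds at whichever premise the
    -- value of x selects.
    ...   | z , z∈ , ¬mz , z∉x = go (value o′ x) refl
      where
      o′ = rebase o z z∈
      ih : ∀ {j} → j <ᶠ i → Unvisited j
      ih j<i = unvisited _ (rs j<i)
      f′ : Falsified o′ i
      f′ {ℓ} ℓ∈ = trans (rebase-value o z z∈ (variableOf ℓ) (λ l∈ → ¬m (lose ℓ∈ l∈)) (λ z∈ → ¬mz (lose ℓ∈ z∈))) (f ℓ∈)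
      a⊆ : label a ⊆ pos x ∷ line i
      a⊆ ∈a with Equivalence.to a≋ ∈a
      ... | here eq  = here eq
      ... | there ∈P = there (Equivalence.from C≋ (∈-++⁺ˡ ∈P))
      b⊆ : label b ⊆ neg x ∷ line i
      b⊆ ∈b with Equivalence.to b≋ ∈b
      ... | here eq  = here eq
      ... | there ∈Q = there (Equivalence.from C≋ (∈-++⁺ʳ P ∈Q))
      go : ∀ v → value o′ x ≡ v → ⊥
      go false eq = premise-contradiction i ih o′ (pos x) a (λ { j refl → premise< j (here refl) }) a⊆
                      (∷-falsified o′ (pos x) eq f′) (∷-unmentioned (pos x) z∉x ¬mz)
      go true  eq = premise-contradiction i ih o′ (neg x) b (λ { j refl → premise< j (there (here refl)) }) b⊆
                      (∷-falsified o′ (neg x) eq f′) (∷-unmentioned (neg x) z∉x ¬mz)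

    axiom-nonempty : ∀ {D} → RLNP n D ⊎ WeightAxiom k D → ∃ λ ℓ → ℓ ∈ D
    axiom-nonempty (inj₁ (irreflexive i))    = _ , here refl
    axiom-nonempty (inj₁ (transitive i j l)) = _ , here refl
    axiom-nonempty (inj₁ (witness j))        = _ , ∈-map⁺ (λ i → pos (S i j)) (∈-allFin j)
    axiom-nonempty (inj₁ (witness-R i j))    = _ , here refl
    axiom-nonempty (inj₁ (witness-L i j))    = _ , here refl
    axiom-nonempty (inj₁ (last-R i eq))      = _ , here refl
    axiom-nonempty (inj₂ (x ∷ xs , _ , _ , refl)) = neg x , here refl

    -- No axiom is empty. An empty line is falsified by every order and mentions nothing, so the
    -- descent could start there with `top` as least element.
    nonempty-label : ∀ ν → ¬ label ν ≋ []
    nonempty-label (inj₁ (D , ax)) D≋[] = ≋[]⇒∉ {C = D} D≋[] (proj₂ (axiom-nonempty ax))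
    nonempty-label (inj₂ i)        i≋[] = unvisited i (Fin.<-wellFounded i) topOrder
      (λ ℓ∈ → ≋[]⇒∉ {C = line i} i≋[] ℓ∈) (λ m → ≋[]⇒∉ {C = line i} i≋[] (proj₁ (proj₂ (find m))))

    no-refutation : ⊥
    no-refutation = nonempty-label root root-empty

-- Parameters, and the size bound in terms of r.

^-cancelˡ-< : ∀ r .{{_ : NonZero r}} {x y} → r ^ x < r ^ y → x < y
^-cancelˡ-< r {x} {y} lt with x <? y
... | yes x<y = x<y
... | no  x≮y = contradiction lt (≤⇒≯ (^-monoʳ-≤ r (≮⇒≥ x≮y)))

m≤m^1+n : ∀ m n .{{_ : NonZero m}} → m ≤ m ^ suc n
m≤m^1+n m n = m≤m*n m (m ^ n) {{m^n≢0 m n}}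

last-unique : ∀ {n} → 1 ≤ n → ∃ λ (top : Fin n) → ∀ i → suc (toℕ i) ≡ n → i ≡ top
last-unique {suc n} _ = fromℕ n , λ i eq → Fin.toℕ-injective (trans (suc-injective eq) (sym (Fin.toℕ-fromℕ n)))

-- J, m and κ are variables so that powers with these exponents do not unfold.
module _ {n k : ℕ} (π : p-Res₁-Refutation (RLNP n) k) (u r J m κ : ℕ)
         (J≡ : J ≡ 2 * (2 * suc u)) (m≡ : m ≡ 2 + J) (κ≡ : κ ≡ J * 2 + suc m + k * 2) where
  open Refutation π using (line)

  private
    a = suc u
    s = size π
    q = κ * r

  -- If it fails, `sample` yields alive elements of potential below r ^ J, `meet-heavy` yields
  -- random values satisfying every heavy line, and the descent gives a contradiction.
  size-bound : 1 ≤ r → q ^ 4 ≤ n → suc m + suc m ≤ n → suc u * suc (u + u) + 2 * a ≤ k →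
               r ^ J ≤ s * (2 * 4 ^ m)
  size-bound 1≤r q⁴≤n m≤n k≥ = ≮⇒≥ contradictory
    where
    open ≤-Reasoning
    suc-m≤κ : suc m ≤ κ
    suc-m≤κ = begin
      suc m                   ≤⟨ m≤n+m (suc m) (J * 2) ⟩
      J * 2 + suc m           ≤⟨ m≤m+n _ (k * 2) ⟩
      J * 2 + suc m + k * 2   ≡⟨ κ≡ ⟨
      κ                       ∎
    instance
      r≢0 : NonZero r
      r≢0 = >-nonZero 1≤r
      κ≢0 : NonZero κ
      κ≢0 = >-nonZero (≤-trans (s≤s z≤n) suc-m≤κ)
      q≢0 : NonZero q
      q≢0 = m*n≢0 κ r
    -- True gets probability 1/(c+1) = 1/q². T random variables all miss with probability at most
    -- q^(-J) by `power-decay`, and W bounds the number of elements mentioned by a line with fewer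
    -- than T of them.
    c T W : ℕ
    c = pred (q * q)
    T = q * c * J
    W = q * (q * q) * κ
    qq : suc c ≡ q * q
    qq = suc-pred (q * q) {{m*n≢0 q q}}
    2≤q : 2 ≤ q
    2≤q = begin
      2       ≤⟨ m≤m+n 2 (suc J) ⟩
      2 + suc J   ≡⟨ +-suc 2 J ⟩
      3 + J   ≡⟨ cong suc m≡ ⟨
      suc m   ≤⟨ suc-m≤κ ⟩
      κ       ≤⟨ m≤m*n κ r ⟩
      q       ∎
    1≤c : 1 ≤ c
    1≤c = s≤s⁻¹ (begin
      2      ≤⟨ 2≤q ⟩
      q      ≤⟨ m≤m*n q q ⟩
      q * q  ≡⟨ qq ⟨
      suc c  ∎)
    W≥ : suc m + T * 2 ≤ W
    W≥ = begin
      suc m + T * 2                            ≤⟨ +-mono-≤ (m≤n*m (suc m) Q {{m*n≢0 q (q * q) {{q≢0}} {{m*n≢0 q q}}}})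
                                                    (*-monoˡ-≤ 2 (*-monoˡ-≤ J (*-monoʳ-≤ q (≤-trans (n≤1+n c) (≤-reflexive qq))))) ⟩
      Q * suc m + Q * J * 2                    ≡⟨ lemma Q (suc m) J ⟩
      Q * (J * 2 + suc m)                      ≤⟨ *-monoʳ-≤ Q (≤-trans (m≤m+n (J * 2 + suc m) (k * 2)) (≤-reflexive (sym κ≡))) ⟩
      W                                        ∎
      where
      Q = q * (q * q)
      lemma : ∀ Q m J → Q * m + Q * J * 2 ≡ Q * (J * 2 + m)
      lemma = solve-∀
    rW≤n : r * W ≤ n
    rW≤n = begin
      r * (q * (q * q) * κ) ≡⟨ lemma r κ q ⟩
      q * (q * q) * (κ * r) ≡⟨ lemma′ q ⟩
      q ^ 4                 ≤⟨ q⁴≤n ⟩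
      n                     ∎
      where
      lemma : ∀ r k q → r * (q * (q * q) * k) ≡ q * (q * q) * (k * r)
      lemma = solve-∀
      lemma′ : ∀ q → q * (q * q) * q ≡ q * (q * (q * (q * 1)))
      lemma′ = solve-∀
    r⁴k≤n : r ^ 4 * (k * 2) ≤ n
    r⁴k≤n = begin
      r ^ 4 * (k * 2) ≤⟨ *-monoʳ-≤ (r ^ 4) (≤-trans (m≤n+m (k * 2) (J * 2 + suc m)) (≤-trans (≤-reflexive (sym κ≡)) (m≤m^1+n κ 3))) ⟩
      r ^ 4 * κ ^ 4   ≡⟨ *-comm (r ^ 4) (κ ^ 4) ⟩
      κ ^ 4 * r ^ 4   ≡⟨ *-^-distrib κ r 4 ⟨
      q ^ 4           ≤⟨ q⁴≤n ⟩
      n               ∎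
    T<n : T < n
    T<n = begin-strict
      T             <⟨ s≤s (≤-trans (m≤m*n T 2) (m≤n+m (T * 2) m)) ⟩
      suc m + T * 2 ≤⟨ W≥ ⟩
      W             ≤⟨ m≤n*m W r ⟩
      r * W         ≤⟨ rW≤n ⟩
      n             ∎
    1≤n : 1 ≤ n
    1≤n = ≤-trans (s≤s z≤n) m≤n

    open Sampling {n}
    -- Truncation makes both sets sparse for every line. At W a light line loses nothing, and k
    -- negated variables are enough against a weight axiom.
    narrow short : Fin s → List (Fin n)
    narrow i = take W (mentioned (line i))
    short  i = concatMap endpoints (take k (negated (line i)))
    Es : List (List (Fin n) × ℕ)
    -- A potential below r ^ J then means fewer than J hits in `narrow i`, and, by the base r ^ 4,
    -- fewer than J/4 = a hits in `short i`.
    Es = map (λ i → narrow i , r) (allFin s) ++ map (λ i → short i , r ^ 4) (allFin s)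
    narrow∈ : ∀ i → (narrow i , r) ∈ Es
    narrow∈ i = ∈-++⁺ˡ (∈-map⁺ (λ i → narrow i , r) (∈-allFin i))
    short∈ : ∀ i → (short i , r ^ 4) ∈ Es
    short∈ i = ∈-++⁺ʳ (map (λ i → narrow i , r) (allFin s)) (∈-map⁺ (λ i → short i , r ^ 4) (∈-allFin i))
    sparse : Sparse Es
    sparse E∈ with ∈-++⁻ (map (λ i → narrow i , r) (allFin s)) E∈
    ... | inj₁ p with ∈-map⁻ (λ i → narrow i , r) p
    ...   | i , _ , refl = ≤-trans (*-monoʳ-≤ r (≤-trans (≤-reflexive (length-take W _)) (m⊓n≤m W _))) rW≤n
    sparse E∈ | inj₂ p with ∈-map⁻ (λ i → short i , r ^ 4) p
    ...   | i , _ , refl = ≤-trans (*-monoʳ-≤ (r ^ 4) (≤-trans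
              (length-concatMap-≤ endpoints 2 (take k (negated (line i))) (λ {x} _ → length-endpoints x))
              (*-monoˡ-≤ 2 (≤-trans (≤-reflexive (length-take k _)) (m⊓n≤m k _))))) r⁴k≤n
    length-Es : length Es ≡ s + s
    length-Es = trans (length-++ (map (λ i → narrow i , r) (allFin s)))
      (cong₂ _+_ (trans (length-map _ (allFin s)) (length-tabulate {n = s} id))
                 (trans (length-map _ (allFin s)) (length-tabulate {n = s} id)))

    module Sampled (small : s * (2 * 4 ^ m) < r ^ J)
                   (top : Fin n) (top-last : ∀ i → suc (toℕ i) ≡ n → i ≡ top)
                   (As : List (Fin n)) (unique-As : Unique As) (length-As : length As ≡ m)
                   (potential< : potential Es As < r ^ J) where

      hits-narrow : ∀ i → hits (narrow i) As < J
      hits-narrow i = ^-cancelˡ-< r (≤-<-trans (∈⇒≤sum (λ (U , ρ) → ρ ^ hits U As) (narrow∈ i)) potential<)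
      hits-short : ∀ i → hits (short i) As ≤ u
      hits-short i = s≤s⁻¹ (*-cancelˡ-< 4 _ _ (subst (4 * hits (short i) As <_) (trans J≡ (lemma u))
        (^-cancelˡ-< r (subst (_< r ^ J) (^-*-assoc r 4 (hits (short i) As))
          (≤-<-trans (∈⇒≤sum (λ (U , ρ) → ρ ^ hits U As) (short∈ i)) potential<)))))
        where
        lemma : ∀ u → 2 * (2 * suc u) ≡ 4 * suc u
        lemma = solve-∀

      open Critical top As
      open Conditioning (_≟ⱽ_ {n})
      -- Either way the random values miss the line with probability at most q^(-J).
      Heavy : Fin s → Set
      Heavy i = T ≤ length (randomVars (line i)) ⊎ 2 * a ≤ length (randomNegated (line i))
      heavy? : ∀ i → Dec (Heavy i)
      heavy? i = (T ≤? length (randomVars (line i))) ⊎-dec (2 * a ≤? length (randomNegated (line i)))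
      gs = map (target ∘ line) (filter heavy? (allFin s))
      gs-heavy : ∀ {g} → g ∈ gs → T ≤ length (targeted (allVars n) g) ⊎ 2 * a ≤ length (falseTargeted (allVars n) g)
      gs-heavy g∈ with ∈-map⁻ (target ∘ line) g∈
      ... | i , i∈ , refl = proj₂ (∈-filter⁻ heavy? {xs = allFin s} i∈)
      s<qᴶ : length gs < q ^ J
      s<qᴶ = begin-strict
        length gs                                  ≡⟨ length-map (target ∘ line) (filter heavy? (allFin s)) ⟩
        length (filter heavy? (allFin s))          ≤⟨ length-filter heavy? (allFin s) ⟩
        length (allFin s)                          ≡⟨ length-tabulate {n = s} id ⟩
        s                                          ≤⟨ m≤m*n s (2 * 4 ^ m) {{m*n≢0 2 (4 ^ m) {{_}} {{m^n≢0 4 m}}}} ⟩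
        s * (2 * 4 ^ m)                            <⟨ small ⟩
        r ^ J                                      ≤⟨ ^-monoˡ-≤ J (m≤n*m r κ) ⟩
        q ^ J                                      ∎
      -- J = 4a is chosen so that 2a negated random variables, each true with probability 1/q², are
      -- all true with probability q^(-J).
      qᴶ≤ : q ^ J ≤ suc c ^ (2 * a)
      qᴶ≤ = begin
        q ^ J               ≡⟨ cong (q ^_) J≡ ⟩
        q ^ (2 * (2 * a))   ≡⟨ ^-*-assoc q 2 (2 * a) ⟨
        (q ^ 2) ^ (2 * a)   ≡⟨ cong (_^ (2 * a)) (cong (q *_) (*-identityʳ q)) ⟩
        (q * q) ^ (2 * a)   ≡⟨ cong (_^ (2 * a)) qq ⟨
        suc c ^ (2 * a)     ∎

      module Assigned (M : Var n → Bool)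
                      (meets : ∀ {g} → g ∈ gs → Meets (allVars n) M g) where

        open Assignments M
        open Walk π top As M

        light : ∀ i o → Falsified o i → ¬ Heavy i
        light i o f heavy = falsified⇒¬meets o {line i} f
          (meets (∈-map⁺ (target ∘ line) (∈-filter⁺ heavy? (∈-allFin i) heavy)))

        fresh-in : ∀ i o → Falsified o i → ∀ x → ∃ λ z → z ∈ alive × ¬ Mentions (line i) z × z ∉ mentions x
        fresh-in i o f x with fresh (line i) x few unique-As
          where
          mentioned≤W : length (mentioned (line i)) ≤ W
          mentioned≤W = begin
            length (mentioned (line i))                              ≤⟨ mentioned-bound (line i) ⟩
            suc (length As) + length (randomVars (line i)) * 2       ≤⟨ +-mono-≤ (≤-reflexive (cong suc length-As)) (*-monoˡ-≤ 2 (<⇒≤ (≰⇒> (light i o f ∘ inj₁)))) ⟩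
            suc m + T * 2                                            ≤⟨ W≥ ⟩
            W                                                        ∎
          -- m = 2 + J leaves room for the 2 elements of x beside fewer than J hits.
          few : 2 + hits (mentioned (line i)) As < length As
          few = subst (2 + hits (mentioned (line i)) As <_) (sym (trans length-As m≡))
            (+-monoʳ-< 2 (subst (λ U → hits U As < J) (take-all W (mentioned (line i)) mentioned≤W) (hits-narrow i)))
        ... | z , z∈ , p = z , there z∈ , p

        no-axiom : ∀ i o ℓ D → Falsified o i → (RLNP n D ⊎ WeightAxiom k D) → D ⊆ ℓ ∷ line i →
                   Falsifies (value o) D → ¬ Mentions D (Order.least o) → ⊥
        no-axiom i o ℓ D f (inj₁ ax) D⊆ fD ¬m with falsified-RLNP top-last o ax fD ¬m
        -- The line would have at least n - 1 random variables, but it has fewer than T, and T < n.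
        ... | j , j∉ , ∈D = contradiction T<n (≤⇒≯ (≤-trans (column-bound {line i} {ℓ} j∉ (D⊆ ∘ ∈D)) (≰⇒> (light i o f ∘ inj₁))))
        -- At least k - a(2a - 1) ≥ 2a of the negated variables would be random, making the line
        -- heavy.
        no-axiom i o ℓ D f (inj₂ ax) D⊆ fD ¬m = light i o f (inj₂ (+-cancelˡ-≤ (suc u * suc (u + u)) _ _ (≤-trans k≥
          (falsified-negated o {line i} k u f (weight-negated (line i) ax D⊆) (hits-short i)))))

        contradictory : ⊥
        contradictory = no-refutation fresh-in no-axiom

      contradictory : ⊥
      contradictory = let (M , meets) = meet-heavy c (allVars-unique n) 1≤c T (2 * a) (q ^ J) gs
                            (power-decay c {{>-nonZero 1≤c}} q J) qᴶ≤ gs-heavy s<qᴶ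
                      in Assigned.contradictory M meets

    contradictory : ¬ s * (2 * 4 ^ m) < r ^ J
    contradictory small with last-unique 1≤n
    ... | top , top-last with sample Es sparse 1≤n top m m≤n
    ...   | As , (_ ∷ unique-As) , length-As , potential≤ =
      Sampled.contradictory small top top-last As unique-As length-As (begin-strict
        potential Es As       ≤⟨ potential≤ ⟩
        length Es * 4 ^ m     ≡⟨ cong (_* 4 ^ m) length-Es ⟩
        (s + s) * 4 ^ m       ≡⟨ lemma s (4 ^ m) ⟩
        s * (2 * 4 ^ m)       <⟨ small ⟩
        r ^ J                 ∎)
      where
      lemma : ∀ s p → (s + s) * p ≡ s * (2 * p)
      lemma = solve-∀

-- From the size bound in r to the power of n.

-- N + 1 ≤ 16 a² gives (t/4)² ≤ (at)² - p² = d (at + p) ≤ 2 a t d.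
gap : ∀ a N p t .{{_ : NonZero t}} → N < 16 * a ^ 2 → 16 * p ^ 2 ≤ N * t ^ 2 →
      ∃ λ d → a * t ≡ p + d × t ≤ 32 * a * d
gap a N p t N< p≤ = d , at≡ , *-cancelʳ-≤ t (32 * a * d) t (+-cancelˡ-≤ (16 * p ^ 2) _ _ (begin
  16 * p ^ 2 + t * t                      ≤⟨ +-monoˡ-≤ (t * t) p≤ ⟩
  N * t ^ 2 + t * t                       ≡⟨ lemma₁ N t ⟩
  suc N * t ^ 2                           ≤⟨ *-monoˡ-≤ (t ^ 2) N< ⟩
  16 * a ^ 2 * t ^ 2                      ≡⟨ lemma₂ a t ⟩
  16 * (a * t) ^ 2                        ≡⟨ cong (λ x → 16 * x ^ 2) at≡ ⟩
  16 * (p + d) ^ 2                        ≤⟨ m≤m+n _ (16 * d ^ 2) ⟩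
  16 * (p + d) ^ 2 + 16 * d ^ 2           ≡⟨ lemma₃ p d ⟩
  16 * p ^ 2 + 32 * (p + d) * d           ≡⟨ cong (λ x → 16 * p ^ 2 + 32 * x * d) at≡ ⟨
  16 * p ^ 2 + 32 * (a * t) * d           ≡⟨ lemma₄ p a t d ⟩
  16 * p ^ 2 + 32 * a * d * t             ∎))
  where
  open ≤-Reasoning
  lemma₁ : ∀ N t → N * (t * (t * 1)) + t * t ≡ suc N * (t * (t * 1))
  lemma₁ = solve-∀
  lemma₂ : ∀ a t → 16 * (a * (a * 1)) * (t * (t * 1)) ≡ 16 * ((a * t) * ((a * t) * 1))
  lemma₂ = solve-∀
  lemma₃ : ∀ p d → 16 * ((p + d) * ((p + d) * 1)) + 16 * (d * (d * 1)) ≡ 16 * (p * (p * 1)) + 32 * (p + d) * d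
  lemma₃ = solve-∀
  lemma₄ : ∀ p a t d → 16 * (p * (p * 1)) + 32 * (a * t) * d ≡ 16 * (p * (p * 1)) + 32 * a * d * t
  lemma₄ = solve-∀
  p≤at : p ≤ a * t
  p≤at with p ≤? a * t
  ... | yes p≤ = p≤
  ... | no p≰ = contradiction (begin-strict
    16 * p ^ 2          ≤⟨ p≤ ⟩
    N * t ^ 2           <⟨ *-monoˡ-< (t ^ 2) {{m^n≢0 t 2}} N< ⟩
    16 * a ^ 2 * t ^ 2  ≡⟨ lemma₂ a t ⟩
    16 * (a * t) ^ 2    ≤⟨ *-monoʳ-≤ 16 (^-monoˡ-≤ 2 (<⇒≤ (≰⇒> p≰))) ⟩
    16 * p ^ 2          ∎) (<-irrefl refl)
  d = a * t ∸ p
  at≡ : a * t ≡ p + d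
  at≡ = sym (m+[n∸m]≡n p≤at)

-- The surplus n^d in n^(at) = n^p n^d pays for the constant, since B^t ≤ B^(ed) ≤ n^d.
absorb-constant : ∀ {a e B s n p d t} .{{_ : NonZero B}} → a * t ≡ p + d → t ≤ e * d →
                  n ^ a ≤ s * B → B ^ e ≤ n → n ^ p ≤ s ^ t
absorb-constant {a} {e} {B} {s} {n} {p} {d} {t} at≡ t≤ n^a≤ B≤n =
  *-cancelʳ-≤ (n ^ p) (s ^ t) (B ^ t) {{m^n≢0 B t}} (begin
    n ^ p * B ^ t         ≤⟨ *-monoʳ-≤ (n ^ p) (^-monoʳ-≤ B t≤) ⟩
    n ^ p * B ^ (e * d)   ≡⟨ cong (n ^ p *_) (^-*-assoc B e d) ⟨
    n ^ p * (B ^ e) ^ d   ≤⟨ *-monoʳ-≤ (n ^ p) (^-monoˡ-≤ d B≤n) ⟩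
    n ^ p * n ^ d         ≡⟨ ^-distribˡ-+-* n p d ⟨
    n ^ (p + d)           ≡⟨ cong (n ^_) at≡ ⟨
    n ^ (a * t)           ≡⟨ ^-*-assoc n a t ⟨
    (n ^ a) ^ t           ≤⟨ ^-monoˡ-≤ t n^a≤ ⟩
    (s * B) ^ t           ≡⟨ *-^-distrib s B t ⟩
    s ^ t * B ^ t         ∎)
  where open ≤-Reasoning

-- The left side is 2u² + 5u + 3, and u ≤ u².
k-large : ∀ k u → 3 ≤ k → 16 * u ^ 2 ≤ k ∸ 3 → suc u * suc (u + u) + 2 * suc u ≤ k
k-large k u 3≤k u≤ = begin
  suc u * suc (u + u) + 2 * suc u  ≡⟨ lemma₁ u ⟩
  5 * u + 2 * u ^ 2 + 3            ≤⟨ +-monoˡ-≤ 3 (+-monoˡ-≤ (2 * u ^ 2) (*-monoʳ-≤ 5 (u≤u² u))) ⟩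
  5 * u ^ 2 + 2 * u ^ 2 + 3        ≤⟨ m≤m+n _ (9 * u ^ 2) ⟩
  5 * u ^ 2 + 2 * u ^ 2 + 3 + 9 * u ^ 2 ≡⟨ lemma₂ u ⟩
  16 * u ^ 2 + 3                   ≤⟨ +-monoˡ-≤ 3 u≤ ⟩
  k ∸ 3 + 3                        ≡⟨ m∸n+n≡m 3≤k ⟩
  k                                ∎
  where
  open ≤-Reasoning
  lemma₁ : ∀ u → suc u * suc (u + u) + 2 * suc u ≡ 5 * u + 2 * (u * (u * 1)) + 3
  lemma₁ = solve-∀
  lemma₂ : ∀ u → 5 * (u * (u * 1)) + 2 * (u * (u * 1)) + 3 + 9 * (u * (u * 1)) ≡ 16 * (u * (u * 1)) + 3
  lemma₂ = solve-∀
  u≤u² : ∀ u → u ≤ u ^ 2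
  u≤u² zero    = z≤n
  u≤u² (suc u) = m≤m^1+n (suc u) 1

asymptotic : ∀ k u e J m κ → e ≡ 32 * suc u → J ≡ 2 * (2 * suc u) → m ≡ 2 + J → κ ≡ J * 2 + suc m + k * 2 →
  3 ≤ k → 16 * u ^ 2 ≤ k ∸ 3 → k ∸ 3 < 16 * suc u ^ 2 →
  ∃[ n₀ ] (∀ n → n₀ ≤ n → (π : p-Res₁-Refutation (RLNP n) k) → size π ≥ n ^√[ k ∸ 3 / 16 ])
asymptotic k u e J m κ e≡ J≡ m≡ κ≡ 3≤k u≤ <a = n₀ , bound
  where
  a B n₀ : ℕ
  a  = suc u
  B  = (2 * κ) ^ J * (2 * 4 ^ m)
  -- The summands serve, in this order, to absorb B, to make r positive, and to leave enough
  -- elements for the sampling.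
  n₀ = B ^ e + (κ ^ 4 + (suc m + suc m))
  instance
    κ≢0 : NonZero κ
    κ≢0 = >-nonZero (≤-trans (≤-trans (s≤s z≤n) (m≤n+m (suc m) (J * 2)))
                             (≤-trans (m≤m+n _ (k * 2)) (≤-reflexive (sym κ≡))))
    B≢0 : NonZero B
    B≢0 = m*n≢0 _ _ {{m^n≢0 (2 * κ) J {{m*n≢0 2 κ}}}} {{m*n≢0 2 (4 ^ m) {{_}} {{m^n≢0 4 m}}}}
  open ≤-Reasoning
  bound : ∀ n → n₀ ≤ n → (π : p-Res₁-Refutation (RLNP n) k) → size π ≥ n ^√[ k ∸ 3 / 16 ]
  -- With r such that (κr)^4 ≤ n < (κ(r + 1))^4, the power r ^ J = r ^ (4a) is n ^ a up to a
  -- constant factor.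
  bound n n₀≤n π with bracket {λ x → (κ * x) ^ 4} {n} (suc n) (subst (λ x → x ^ 4 ≤ n) (sym (*-zeroʳ κ)) z≤n)
                         (≤-trans (m≤n*m (suc n) κ) (m≤m^1+n (κ * suc n) 3 {{m*n≢0 κ (suc n)}}))
  ... | zero  , _ , n< = contradiction (subst (λ x → n < x ^ 4) (*-identityʳ κ) n<)
                           (≤⇒≯ (≤-trans (≤-trans (m≤m+n (κ ^ 4) _) (m≤n+m _ (B ^ e))) n₀≤n))
  ... | r@(suc r-1) , r≤ , n< = λ p t p≤ → let (d , at≡ , t≤) = gap a (k ∸ 3) p t <a p≤ in
      absorb-constant {a = a} {e} {B} {size π} {n} {p} {d} {t} at≡ (subst (λ e → t ≤ e * d) (sym e≡) t≤) n^a≤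
        (≤-trans (m≤m+n (B ^ e) _) n₀≤n)
    where
    n≤ : n ≤ (2 * κ * r) ^ 4
    n≤ = begin
      n                     ≤⟨ <⇒≤ n< ⟩
      (κ * suc r) ^ 4       ≤⟨ ^-monoˡ-≤ 4 (*-monoʳ-≤ κ (s≤s (m≤n+m r r-1))) ⟩
      (κ * (r + r)) ^ 4     ≡⟨ cong (_^ 4) (lemma κ r) ⟩
      (2 * κ * r) ^ 4       ∎
      where
      lemma : ∀ κ r → κ * (r + r) ≡ 2 * κ * r
      lemma = solve-∀
    n^a≤ : n ^ a ≤ size π * B
    n^a≤ = begin
      n ^ a                               ≤⟨ ^-monoˡ-≤ a n≤ ⟩
      ((2 * κ * r) ^ 4) ^ a               ≡⟨ ^-*-assoc (2 * κ * r) 4 a ⟩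
      (2 * κ * r) ^ (4 * a)               ≡⟨ cong ((2 * κ * r) ^_) (trans (*-assoc 2 2 a) (sym J≡)) ⟩
      (2 * κ * r) ^ J                     ≡⟨ *-^-distrib (2 * κ) r J ⟩
      (2 * κ) ^ J * r ^ J                 ≤⟨ *-monoʳ-≤ ((2 * κ) ^ J) (size-bound π u r J m κ J≡ m≡ κ≡ (s≤s z≤n) r≤
                                               (≤-trans (≤-trans (m≤n+m _ (κ ^ 4)) (m≤n+m _ (B ^ e))) n₀≤n)
                                               (k-large k u 3≤k u≤)) ⟩
      (2 * κ) ^ J * (size π * (2 * 4 ^ m)) ≡⟨ lemma ((2 * κ) ^ J) (size π) (2 * 4 ^ m) ⟩
      size π * B                          ∎
      where
      lemma : ∀ x y z → x * (y * z) ≡ y * (x * z)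
      lemma = solve-∀

scaled-√ : ∀ c N .{{_ : NonZero c}} → ∃[ u ] c * u ^ 2 ≤ N × N < c * suc u ^ 2
scaled-√ c N = bracket {λ x → c * x ^ 2} (suc N) (≤-trans (≤-reflexive (*-zeroʳ c)) z≤n)
  (≤-trans (m≤m^1+n (suc N) 1) (m≤n*m (suc N ^ 2) c))

theorem1 : ∀ (k : ℕ) → 3 ≤ k →
    ∃[ n₀ ] (∀ (n : ℕ) → n₀ ≤ n →
    (π : p-Res₁-Refutation (RLNP n) k) → size π ≥ n ^√[ k ∸ 3 / 16 ])
-- The a of the argument is u + 1, the least integer with 16a² > k - 3.
theorem1 k 3≤k = let (u , u≤ , <a) = scaled-√ 16 (k ∸ 3) in
  asymptotic k u _ _ _ _ refl refl refl refl 3≤k u≤ <a
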